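{- Let $n$ be a natural number not divisible by $3$, let $u$ be the congruence class of $\|n\|_{\mathrm{st}}$ modulo $3$, and let $\alpha$ be the ordinal with $\delta_{\mathrm{st}}(n)=\mathscr{D}^u_{\mathrm{st}}[\alpha]$. Then the set $\{\mathscr{D}^{u+1}_{\mathrm{st}}[\omega\alpha+k]:k\in\mathbb{Z}_{\ge0}\}$, which equals $\mathscr{D}^{u+1}_{\mathrm{st}}\cap[\mathscr{D}^{u+1}_{\mathrm{st}}[\omega\alpha],\delta_{\mathrm{st}}(n)+1)$, has finite symmetric difference with the set \[\{\delta_{\mathrm{st}}(b(a3^k+1)):k\ge0,\ a,b\in\mathbb{N},\ ab=n,\ \|n\|_{\mathrm{st}}=\|a\|_{\mathrm{st}}+\|b\|_{\mathrm{st}}\}.\] Similarly, if $\delta_{\mathrm{st}}(n)=\mathscr{D}_{\mathrm{st}}[\alpha]$, then the set $\{\mathscr{D}_{\mathrm{st}}[\omega\alpha+k]:k\in\mathbb{Z}_{\ge0}\}$, which equals $\mathscr{D}_{\mathrm{st}}\cap[\mathscr{D}_{\mathrm{st}}[\omega\alpha],\delta_{\mathrm{st}}(n)+1)$, has finite symmetric difference with the same set $\{\delta_{\mathrm{st}}(b(a3^k+1)):k\ge0,\ ab=n,\ \|n\|_{\mathrm{st}}=\|a\|_{\mathrm{st}}+\|b\|_{\mathrm{st}}\}$.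
   Context: $\|n\|$ denotes the integer complexity of $n\in\mathbb{N}$ (least number of $1$'s needed to write $n$ using $1$, $+$, $\cdot$ and parentheses), and $\delta(n)=\|n\|-3\log_3 n$. $n$ is stable if $\|3^kn\|=3k+\|n\|$ for all $k\ge0$; for every $n$ some $3^kn$ is stable, and $\|n\|_{\mathrm{st}}=\|3^kn\|-3k$, $\delta_{\mathrm{st}}(n)=\delta(3^kn)$ for any such $k$. $\mathscr{D}_{\mathrm{st}}=\{\delta(n):n\text{ stable}\}$ and, for a congruence class $u$ mod $3$, $\mathscr{D}^u_{\mathrm{st}}=\{\delta(n):n>1\text{ stable},\ \|n\|\equiv u\pmod3\}$; these are well-ordered subsets of $\mathbb{R}$. For a well-ordered set $S$ and ordinal $\gamma$, $S[\gamma]$ denotes the element of $S$ whose set of predecessors in $S$ has order type $\gamma$. -}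

module Defs where

open import Data.Nat using (ℕ; zero; suc; _+_; _*_; _^_; _≤_; _<_; _⊓_; _≡ᵇ_; _≤ᵇ_; _%_)
open import Data.Bool using (if_then_else_)
open import Data.List using (List; []; _∷_; foldr; concatMap)
open import Data.List.Relation.Unary.Any using (Any)
open import Data.Fin using (Fin)
open import Data.Product using (Σ; _×_; ∃; ∃-syntax; _,_)
open import Data.Sum using (_⊎_; inj₁; inj₂)
open import Relation.Nullary using (¬_)
open import Relation.Binary.PropositionalEquality using (_≡_)

data Expr : Set where
  one : Expr
  _⊕_ : Expr → Expr → Expr
  _⊗_ : Expr → Expr → Expr

eval : Expr → ℕ
eval one = 1
eval (e ⊕ f) = eval e + eval f
eval (e ⊗ f) = eval e * eval f

size : Expr → ℕ
size one = 1
size (e ⊕ f) = size e + size f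
size (e ⊗ f) = size e + size f

exprsUpTo : ℕ → List Expr
exprsUpTo zero = []
exprsUpTo (suc s) = one ∷ concatMap (λ a → concatMap (λ b →
    if size a + size b ≤ᵇ suc s then (a ⊕ b) ∷ (a ⊗ b) ∷ [] else []) prev) prev
  where prev = exprsUpTo s

-- ‖n‖ : least number of 1's in an expression evaluating to n (n ≥ 1;
-- n itself is an upper bound since 1+1+…+1 works).  ‖0‖ = 0 (junk).
cpx : ℕ → ℕ
cpx n = foldr (λ e acc → if eval e ≡ᵇ n then size e ⊓ acc else acc) n (exprsUpTo n)

-- Values of δ, represented exactly without reals.
-- A pair (c , m) with m ≥ 1 stands for the real number c - 3 log₃ m.
-- δ(n) = ‖n‖ - 3 log₃ n is represented by (‖n‖ , n).

Val : Set
Val = ℕ × ℕ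

-- c - 3log₃ m < c' - 3log₃ m'  ⇔  3^c · m'^3 < 3^c' · m^3
_<ᵥ_ : Val → Val → Set
(c , m) <ᵥ (c' , m') = 3 ^ c * m' ^ 3 < 3 ^ c' * m ^ 3

_≤ᵥ_ : Val → Val → Set
(c , m) ≤ᵥ (c' , m') = 3 ^ c * m' ^ 3 ≤ 3 ^ c' * m ^ 3

_≈ᵥ_ : Val → Val → Set
(c , m) ≈ᵥ (c' , m') = 3 ^ c * m' ^ 3 ≡ 3 ^ c' * m ^ 3

plusOne : Val → Val
plusOne (c , m) = (suc c , m)

δ : ℕ → Val
δ n = (cpx n , n)

-- Stability and the sets D_st, D^u_st (as predicates on representatives;
-- the actual sets are the images under δ)

Stable : ℕ → Set
Stable n = ∀ k → cpx (3 ^ k * n) ≡ 3 * k + cpx n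

Dst : ℕ → Set
Dst m = 1 ≤ m × Stable m

DstU : ℕ → ℕ → Set
DstU u m = 2 ≤ m × Stable m × cpx m % 3 ≡ u

-- Linear orders given by a carrier, an equivalence and a strict order,
-- and order isomorphisms between them (used to express order types).

record Lin : Set₁ where
  field
    Carrier : Set
    eqL : Carrier → Carrier → Set
    ltL : Carrier → Carrier → Set

open Lin

OrdIso : Lin → Lin → Set
OrdIso A B = Σ (Carrier A → Carrier B) λ f →
    (∀ a a' → eqL A a a' → eqL B (f a) (f a'))
  × (∀ a a' → ltL A a a' → ltL B (f a) (f a'))
  × (∀ b → ∃[ a ] eqL B (f a) b)

PredLin : (ℕ → Set) → Val → Lin
PredLin D v = record
  { Carrier = Σ ℕ (λ m → D m × δ m <ᵥ v)
  ; eqL = λ { (m , _) (m' , _) → δ m ≈ᵥ δ m' }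
  ; ltL = λ { (m , _) (m' , _) → δ m <ᵥ δ m' } }

-- ω·α where α is the order type of L : α copies of ω, ordered
-- lexicographically with the α-coordinate most significant
omegaTimes : Lin → Lin
omegaTimes L = record
  { Carrier = Carrier L × ℕ
  ; eqL = λ { (p , i) (p' , i') → eqL L p p' × i ≡ i' }
  ; ltL = λ { (p , i) (p' , i') → ltL L p p' ⊎ (eqL L p p' × i < i') } }

plusFin : Lin → ℕ → Lin
plusFin L k = record
  { Carrier = Carrier L ⊎ Fin k
  ; eqL = λ { (inj₁ a) (inj₁ b) → eqL L a b
            ; (inj₂ i) (inj₂ j) → i ≡ j
            ; _ _ → ⊥' }
  ; ltL = λ { (inj₁ a) (inj₁ b) → ltL L a b
            ; (inj₁ _) (inj₂ _) → ⊤'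
            ; (inj₂ _) (inj₁ _) → ⊥'
            ; (inj₂ i) (inj₂ j) → Data.Fin._<_ i j } }
  where
  open import Data.Empty renaming (⊥ to ⊥')
  open import Data.Unit renaming (⊤ to ⊤')
  import Data.Fin

-- Sets of reals (as predicates on Val, closed under ≈ᵥ)

-- v ∈ { S[ωα + k] : k ≥ 0 }, where S = δ(D) and α is the order type of L
OmegaAlphaPlusK : (ℕ → Set) → Lin → Val → Set
OmegaAlphaPlusK D L v =
  ∃[ m ] D m × v ≈ᵥ δ m × ∃[ k ] OrdIso (PredLin D (δ m)) (plusFin (omegaTimes L) k)

IntervalSet : (ℕ → Set) → Lin → Val → Val → Set
IntervalSet D L top v =
  ∃[ m ] D m × v ≈ᵥ δ m × δ m <ᵥ top ×
  (∃[ x ] D x × OrdIso (PredLin D (δ x)) (omegaTimes L) × δ x ≤ᵥ δ m)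

-- { δ_st(b(a3^k+1)) : k ≥ 0, ab = n, ‖n‖_st = ‖a‖_st + ‖b‖_st },
-- where 3^kn·n is a stable multiple of n (so ‖n‖_st = ‖3^kn n‖ - 3kn)
TSet : ℕ → ℕ → Val → Set
TSet n kn v =
  ∃[ k ] ∃[ a ] ∃[ b ] ∃[ ka ] ∃[ kb ] ∃[ j ]
    a * b ≡ n
  × Stable (3 ^ ka * a) × Stable (3 ^ kb * b)
  × cpx (3 ^ kn * n) + 3 * ka + 3 * kb ≡ cpx (3 ^ ka * a) + cpx (3 ^ kb * b) + 3 * kn
  × Stable (3 ^ j * (b * (a * 3 ^ k + 1)))
  × v ≈ᵥ δ (3 ^ j * (b * (a * 3 ^ k + 1)))

FinSymDiff : (Val → Set) → (Val → Set) → Set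
FinSymDiff S T = ∃[ L ] ∀ (v : Val) →
  ((S v × ¬ T v) ⊎ (T v × ¬ S v)) → Any (v ≈ᵥ_) L

SameSet : (Val → Set) → (Val → Set) → Set
SameSet S T = ∀ v → (S v → T v) × (T v → S v)

{-# OPTIONS --safe #-}

-- A pair (c , m) is the real number c - 3 log₃ m. Let C P be the set of values of the pairs (c , m) with c in the class P such that
-- 3^k m has complexity at most c + 3k for some k; it is closed, and D consists of those points z of C P for which z - 1 is not in
-- C (prev P). The central estimate: an efficient expression is a product of sums a + b, and if some a is very large then its value
-- is just below a point of C (prev P) + 1. Hence if C (prev P) is known on an interval, C P is known, up to finitely many
-- expressions of bounded size, on that interval shifted by 1. Induction on the cost c then shows, effectively, that C P is decidable,
-- well-ordered, without limits from above, and that its limits from below are exactly the points of C (prev P) + 1. So the points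
-- of D between consecutive limits form blocks of type ω, one for each p in D of the previous class, converging to p + 1; an order
-- isomorphism is determined by its domain because D is well-founded. Applied near δ(n) + 1, the central estimate shows that all but
-- finitely many elements of the block of n come from (a + 1) b with a b equal to n up to a power of 3; conversely
-- b (a 3^k + 1) with large k cannot have smaller complexity than the evident one, since δ(n) is isolated in C from below.
module Submission where

open import Defs
open import Data.Bool using (true; false; if_then_else_)
open import Data.Empty using (⊥; ⊥-elim)
open import Data.Fin using (toℕ; fromℕ<)
open import Data.Fin.Properties using (toℕ-fromℕ<; toℕ<n; toℕ-injective)
open import Data.List using (List; []; _∷_; map; filter; foldr; _++_; upTo; cartesianProductWith)
open import Data.List.Membership.Propositional using (_∈_; lose)
open import Data.List.Membership.Propositional.Properties using (∈-concatMap⁺; ∈-map⁺; ∈-filter⁺; ∈-filter⁻; ∈-cartesianProductWith⁺; ∈-upTo⁺)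
open import Data.List.Relation.Unary.All as All using (All; []; _∷_)
import Data.List.Relation.Unary.All.Properties as All
open import Data.List.Relation.Unary.Any as Any using (Any; here; there)
import Data.List.Relation.Unary.Any.Properties as Any
open import Data.Nat
open import Data.Nat.DivMod using (%-distribˡ-+; m%n<n; [m+n]%n≡m%n)
open import Data.Nat.Divisibility using (_∣_; divides; _∣?_; m∣m*n)
open import Data.Nat.Primality using (Prime; prime?; euclidsLemma)
open import Data.Nat.Properties
open import Data.Nat.Tactic.RingSolver using (solve-∀)
open import Data.Product using (Σ; ∃-syntax; _×_; _,_; proj₁; proj₂)
open import Data.Sum using (_⊎_; inj₁; inj₂; [_,_]′)
open import Data.Unit using (⊤; tt)
open import Function using (id; _∘_)
open import Relation.Nullary using (¬_; Dec; yes; no)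
open import Relation.Nullary.Decidable using (from-yes; map′)
open import Relation.Binary.Definitions using (tri<; tri≈; tri>)
open import Relation.Binary.PropositionalEquality

-- The induction runs over the closure `C` because there a slack is allowed: a unit of slack can be
-- given up, which lowers a value by 1, whereas subtracting 1 leads out of D. Its parameter is an
-- arbitrary pair (c , m), attained or not, so that v + 1 and v share m and the recursion is
-- structural in c, for all classes at once. Without excluded middle, a largest point below, a least
-- point above or a predecessor has to be found by search. The central estimate is therefore proved
-- with explicit constants: outside the exceptional case every value in question is that of an
-- expression up to a computed size, hence in a finite list. The constants come from integrality:
-- comparing two values means comparing two natural numbers, so a strict inequality has a gap of at
-- least 1 after cross-multiplication, and this gap bounds how lopsided a sum can be. The estimate
-- is used with two kinds of intervals: one without points of `C (prev P)`, for the induction, and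
-- one with δ(n) as its only point, for the symmetric difference.

-- Expressions and integer complexity.

eval-nonZero : ∀ e → NonZero (eval e)
eval-nonZero one = _
eval-nonZero (e ⊕ f) = >-nonZero (≤-trans (>-nonZero⁻¹ (eval e) {{eval-nonZero e}}) (m≤m+n (eval e) (eval f)))
eval-nonZero (e ⊗ f) = m*n≢0 (eval e) (eval f) {{eval-nonZero e}} {{eval-nonZero f}}

size>0 : ∀ e → 0 < size e
size>0 one = s≤s z≤n
size>0 (e ⊕ f) = ≤-trans (size>0 e) (m≤m+n (size e) (size f))
size>0 (e ⊗ f) = ≤-trans (size>0 e) (m≤m+n (size e) (size f))

pairs : ℕ → Expr → Expr → List Expr
pairs s a b = if size a + size b ≤ᵇ suc s then (a ⊕ b) ∷ (a ⊗ b) ∷ [] else []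

pairs-∈ : ∀ {s a b e} → size a + size b ≤ suc s → e ∈ (a ⊕ b) ∷ (a ⊗ b) ∷ [] → e ∈ pairs s a b
pairs-∈ {s} {a} {b} p q with size a + size b ≤ᵇ suc s | ≤⇒≤ᵇ p
... | true | _ = q

exprsUpTo-complete : ∀ s e → size e ≤ s → e ∈ exprsUpTo s
exprsUpTo-complete zero e p = ⊥-elim (<⇒≱ (size>0 e) p)
exprsUpTo-complete (suc s) one p = here refl
exprsUpTo-complete (suc s) (a ⊕ b) p =
  there (∈-concatMap⁺ _ (lose (exprsUpTo-complete s a (s≤s⁻¹ (<-≤-trans (m<m+n (size a) (size>0 b)) p)))
    (∈-concatMap⁺ (pairs s a) (lose (exprsUpTo-complete s b (s≤s⁻¹ (<-≤-trans (m<n+m (size b) (size>0 a)) p)))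
      (pairs-∈ {s} {a} {b} p (here refl))))))
exprsUpTo-complete (suc s) (a ⊗ b) p =
  there (∈-concatMap⁺ _ (lose (exprsUpTo-complete s a (s≤s⁻¹ (<-≤-trans (m<m+n (size a) (size>0 b)) p)))
    (∈-concatMap⁺ (pairs s a) (lose (exprsUpTo-complete s b (s≤s⁻¹ (<-≤-trans (m<n+m (size b) (size>0 a)) p)))
      (pairs-∈ {s} {a} {b} p (there (here refl)))))))

minSize : ℕ → List Expr → ℕ
minSize n = foldr (λ e acc → if eval e ≡ᵇ n then size e ⊓ acc else acc) n

minSize-≤-base : ∀ n es → minSize n es ≤ n
minSize-≤-base n [] = ≤-refl
minSize-≤-base n (e ∷ es) with eval e ≡ᵇ n
... | true = m≤n⇒o⊓m≤n (size e) (minSize-≤-base n es)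
... | false = minSize-≤-base n es

minSize-≤-size : ∀ n es e → e ∈ es → eval e ≡ n → minSize n es ≤ size e
minSize-≤-size n (e ∷ es) _ (here refl) q with eval e ≡ᵇ n | ≡⇒≡ᵇ (eval e) n q
... | true | _ = m⊓n≤m (size e) _
minSize-≤-size n (f ∷ es) e (there p) q with eval f ≡ᵇ n
... | true = m≤n⇒o⊓m≤n (size f) (minSize-≤-size n es e p q)
... | false = minSize-≤-size n es e p q

minSize-attained : ∀ n es → minSize n es ≡ n ⊎ (∃[ e ] eval e ≡ n × size e ≡ minSize n es)
minSize-attained n [] = inj₁ refl
minSize-attained n (f ∷ es) with eval f ≡ᵇ n | ≡ᵇ⇒≡ (eval f) n
... | false | _ = minSize-attained n es
... | true | q with ⊓-sel (size f) (minSize n es)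
... | inj₁ s = inj₂ (f , q _ , sym s)
... | inj₂ s with minSize-attained n es
... | inj₁ t = inj₁ (trans s t)
... | inj₂ (e , u , t) = inj₂ (e , u , trans t (sym s))

cpx-≤ : ∀ e {n} → eval e ≡ n → cpx n ≤ size e
cpx-≤ e {n} p with size e ≤? n
... | yes q = minSize-≤-size n (exprsUpTo n) e (exprsUpTo-complete n e q) p
... | no q = ≤-trans (minSize-≤-base n (exprsUpTo n)) (<⇒≤ (≰⇒> q))

ones : ∀ n → ∃[ e ] eval e ≡ suc n × size e ≡ suc n
ones zero = one , refl , refl
ones (suc n) with ones n
... | e , p , q = one ⊕ e , cong suc p , cong suc q

shortest : ∀ n .{{_ : NonZero n}} → ∃[ e ] eval e ≡ n × size e ≡ cpx n
shortest (suc n) with minSize-attained (suc n) (exprsUpTo (suc n))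
... | inj₂ r = r
-- The fold returned its default value, the number itself, which a sum of ones attains.
... | inj₁ p with ones n
... | e , q , r = e , q , trans r (sym p)

cpx-* : ∀ m n .{{_ : NonZero m}} .{{_ : NonZero n}} → cpx (m * n) ≤ cpx m + cpx n
cpx-* m n with shortest m | shortest n
... | e , p , q | f , r , s = ≤-trans (cpx-≤ (e ⊗ f) (cong₂ _*_ p r)) (≤-reflexive (cong₂ _+_ q s))

three : Expr
three = one ⊕ (one ⊕ one)

pow3 : ℕ → Expr → Expr
pow3 zero e = e
pow3 (suc k) e = three ⊗ pow3 k e

eval-pow3 : ∀ k e → eval (pow3 k e) ≡ 3 ^ k * eval e
eval-pow3 zero e = sym (*-identityˡ (eval e))
eval-pow3 (suc k) e = trans (cong (3 *_) (eval-pow3 k e)) (sym (*-assoc 3 (3 ^ k) (eval e)))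

size-pow3 : ∀ k e → size (pow3 k e) ≡ 3 * k + size e
size-pow3 zero e = refl
size-pow3 (suc k) e = trans (cong (3 +_) (size-pow3 k e)) (lem k (size e))
  where
  lem : ∀ k s → 3 + (3 * k + s) ≡ 3 * suc k + s
  lem = solve-∀

cpx-3^* : ∀ k m .{{_ : NonZero m}} → cpx (3 ^ k * m) ≤ 3 * k + cpx m
cpx-3^* k m with shortest m
... | e , refl , q = ≤-trans (cpx-≤ (pow3 k e) (eval-pow3 k e)) (≤-reflexive (trans (size-pow3 k e) (cong (3 * k +_) q)))

-- Arithmetic with cubes

*-swap23 : ∀ a b c → a * b * c ≡ a * c * b
*-swap23 = solve-∀

cube-* : ∀ a b → (a * b) ^ 3 ≡ a ^ 3 * b ^ 3
cube-* = lem
  where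
  lem : ∀ a b → (a * b) * ((a * b) * ((a * b) * 1)) ≡ (a * (a * (a * 1))) * (b * (b * (b * 1)))
  lem = solve-∀

3^c*3 : ∀ c m → 3 ^ (3 + c) * m ^ 3 ≡ 3 ^ c * (3 * m) ^ 3
3^c*3 c m = lem (3 ^ c) m
  where
  lem : ∀ x m → 3 * (3 * (3 * x)) * (m * (m * (m * 1))) ≡ x * ((3 * m) * ((3 * m) * ((3 * m) * 1)))
  lem = solve-∀

cube-+-≤ : ∀ {a b} → b ≤ a → (a + b) ^ 3 ≤ a ^ 3 + 7 * (a * a * b)
cube-+-≤ {a} {b} b≤a = begin
  (a + b) ^ 3 ≡⟨ lem a b ⟩
  a * (a * (a * 1)) + (3 * (a * a * b) + 3 * (a * b * b) + b * b * b)
    ≤⟨ +-monoʳ-≤ (a ^ 3) (+-mono-≤ (+-monoʳ-≤ (3 * (a * a * b)) (*-monoʳ-≤ 3 (*-monoˡ-≤ b (*-monoʳ-≤ a b≤a))))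
         (*-monoˡ-≤ b (*-mono-≤ b≤a b≤a))) ⟩
  a * (a * (a * 1)) + (3 * (a * a * b) + 3 * (a * a * b) + a * a * b) ≡⟨ lem₂ (a ^ 3) (a * a * b) ⟩
  a ^ 3 + 7 * (a * a * b) ∎
  where
  open ≤-Reasoning
  lem : ∀ a b → (a + b) * ((a + b) * ((a + b) * 1)) ≡ a * (a * (a * 1)) + (3 * (a * a * b) + 3 * (a * b * b) + b * b * b)
  lem = solve-∀
  lem₂ : ∀ x y → x + (3 * y + 3 * y + y) ≡ x + 7 * y
  lem₂ = solve-∀

cube-mono : ∀ {m n} → m ≤ n → m ^ 3 ≤ n ^ 3
cube-mono = ^-monoˡ-≤ 3

suc-cube-≤ : ∀ y → 3 ≤ y → suc y ^ 3 ≤ 3 * y ^ 3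
suc-cube-≤ _ (s≤s (s≤s (s≤s {n = x} _))) = ≤-trans (m≤m+n (suc (suc (suc (suc x))) ^ 3) _) (≤-reflexive (sym (lem x)))
  where
  lem : ∀ x → 3 * ((3 + x) * ((3 + x) * ((3 + x) * 1))) ≡ (4 + x) * ((4 + x) * ((4 + x) * 1)) + (17 + 33 * x + 15 * x * x + 2 * x * x * x)
  lem = solve-∀

2≤m,n⇒m+n≤m*n : ∀ {m n} → 2 ≤ m → 2 ≤ n → m + n ≤ m * n
2≤m,n⇒m+n≤m*n (s≤s (s≤s {n = m} _)) (s≤s (s≤s {n = n} _)) = ≤-trans (m≤m+n _ (m + n + m * n)) (≤-reflexive (sym (lem m n)))
  where
  lem : ∀ m n → (2 + m) * (2 + n) ≡ (2 + m + (2 + n)) + (m + n + m * n)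
  lem = solve-∀

-- For x, y ≥ 2 the sum is at most the product. A summand 1 still contributes a factor 3 on the
-- right, which pays for (y + 1)³ ≤ 3 y³ once y ≥ 3. The remaining cases are 1 + 1, where 8 ≤ 9, and
-- 1 + 2, where 8 ≤ 3^b forces b ≥ 2.
cube-+-≤-* : ∀ x y a b → 1 ≤ x → 1 ≤ y → x ^ 3 ≤ 3 ^ a → y ^ 3 ≤ 3 ^ b → 1 ≤ a → 1 ≤ b → (x + y) ^ 3 ≤ 3 ^ (a + b)
cube-+-≤-* (suc (suc x)) (suc (suc y)) a b _ _ p q _ _ = begin
  (suc (suc x) + suc (suc y)) ^ 3 ≤⟨ cube-mono (2≤m,n⇒m+n≤m*n {suc (suc x)} {suc (suc y)} (s≤s (s≤s z≤n)) (s≤s (s≤s z≤n))) ⟩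
  (suc (suc x) * suc (suc y)) ^ 3 ≡⟨ cube-* (suc (suc x)) (suc (suc y)) ⟩
  suc (suc x) ^ 3 * suc (suc y) ^ 3 ≤⟨ *-mono-≤ p q ⟩
  3 ^ a * 3 ^ b ≡⟨ ^-distribˡ-+-* 3 a b ⟨
  3 ^ (a + b) ∎
  where open ≤-Reasoning
cube-+-≤-* 1 1 a b _ _ p q r s = ≤-trans (m≤m+n 8 1) (^-monoʳ-≤ 3 {2} {a + b} (+-mono-≤ r s))
cube-+-≤-* 1 2 a 1 _ _ p (s≤s (s≤s (s≤s ()))) r s
cube-+-≤-* 1 2 a (suc (suc b)) _ _ p q r s = ^-monoʳ-≤ 3 {3} {a + suc (suc b)} (+-mono-≤ r (s≤s (s≤s z≤n)))
cube-+-≤-* 2 1 1 b _ _ (s≤s (s≤s (s≤s ()))) q r s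
cube-+-≤-* 2 1 (suc (suc a)) b _ _ p q r s = ^-monoʳ-≤ 3 {3} {suc (suc a) + b} (+-mono-≤ {2} (s≤s (s≤s z≤n)) s)
cube-+-≤-* 1 y@(suc (suc (suc _))) (suc a) b _ _ p q r s = begin
  suc y ^ 3 ≤⟨ suc-cube-≤ y (s≤s (s≤s (s≤s z≤n))) ⟩
  3 * y ^ 3 ≤⟨ *-monoʳ-≤ 3 q ⟩
  3 ^ (1 + b) ≤⟨ ^-monoʳ-≤ 3 (+-monoˡ-≤ b {1} {suc a} (s≤s z≤n)) ⟩
  3 ^ (suc a + b) ∎
  where open ≤-Reasoning
cube-+-≤-* x@(suc (suc (suc x'))) 1 a (suc b) _ _ p q r s = begin
  (x + 1) ^ 3 ≡⟨ cong (_^ 3) (+-comm x 1) ⟩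
  suc x ^ 3 ≤⟨ suc-cube-≤ x (s≤s (s≤s (s≤s z≤n))) ⟩
  3 * x ^ 3 ≤⟨ *-monoʳ-≤ 3 p ⟩
  3 ^ (1 + a) ≤⟨ ^-monoʳ-≤ 3 (≤-trans (≤-reflexive (+-comm 1 a)) (+-monoʳ-≤ a {1} {suc b} (s≤s z≤n))) ⟩
  3 ^ (a + suc b) ∎
  where open ≤-Reasoning

eval³≤3^size : ∀ e → eval e ^ 3 ≤ 3 ^ size e
eval³≤3^size one = s≤s z≤n
eval³≤3^size (e ⊕ f) = cube-+-≤-* (eval e) (eval f) (size e) (size f) (>-nonZero⁻¹ _ {{eval-nonZero e}}) (>-nonZero⁻¹ _ {{eval-nonZero f}})
  (eval³≤3^size e) (eval³≤3^size f) (size>0 e) (size>0 f)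
eval³≤3^size (e ⊗ f) = begin
  (eval e * eval f) ^ 3 ≡⟨ cube-* (eval e) (eval f) ⟩
  eval e ^ 3 * eval f ^ 3 ≤⟨ *-mono-≤ (eval³≤3^size e) (eval³≤3^size f) ⟩
  3 ^ size e * 3 ^ size f ≡⟨ ^-distribˡ-+-* 3 (size e) (size f) ⟨
  3 ^ (size e + size f) ∎
  where open ≤-Reasoning

-- The order of values and the shift by 1.

record V : Set where
  constructor ⟨_,_⟩
  field
    co arg : ℕ
    .{{nz}} : NonZero arg
open V public

toVal : V → Val
toVal v = co v , arg v

infix 4 _≺_ _≼_ _≃_

-- A record instead of the bare inequality, so that both values can be recovered from the type; the
-- products of powers do not determine them.
record _≺_ (v w : V) : Set where
  constructor ≺⁺
  field ≺⁻ : toVal v <ᵥ toVal w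
open _≺_ public

record _≼_ (v w : V) : Set where
  constructor ≼⁺
  field ≼⁻ : toVal v ≤ᵥ toVal w
open _≼_ public

record _≃_ (v w : V) : Set where
  constructor ≃⁺
  field ≃⁻ : toVal v ≈ᵥ toVal w
open _≃_ public

private
  cube≢0 : ∀ v → NonZero (arg v ^ 3)
  cube≢0 v = m^n≢0 (arg v) 3

  cross-≤ : ∀ x y x' y' x'' y'' .{{_ : NonZero y'}} → x * y' ≤ x' * y → x' * y'' ≤ x'' * y' → x * y'' ≤ x'' * y
  cross-≤ x y x' y' x'' y'' p q = *-cancelʳ-≤ _ _ y' (begin
    x * y'' * y' ≡⟨ *-swap23 x y'' y' ⟩
    x * y' * y'' ≤⟨ *-monoˡ-≤ y'' p ⟩
    x' * y * y'' ≡⟨ *-swap23 x' y y'' ⟩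
    x' * y'' * y ≤⟨ *-monoˡ-≤ y q ⟩
    x'' * y' * y ≡⟨ *-swap23 x'' y' y ⟩
    x'' * y * y' ∎)
    where open ≤-Reasoning

  cross-<-≤ : ∀ x y x' y' x'' y'' .{{_ : NonZero y''}} → x * y' < x' * y → x' * y'' ≤ x'' * y' → x * y'' < x'' * y
  cross-<-≤ x y x' y' x'' y'' p q = *-cancelʳ-< y' _ _ (begin-strict
    x * y'' * y' ≡⟨ *-swap23 x y'' y' ⟩
    x * y' * y'' <⟨ *-monoˡ-< y'' p ⟩
    x' * y * y'' ≡⟨ *-swap23 x' y y'' ⟩
    x' * y'' * y ≤⟨ *-monoˡ-≤ y q ⟩
    x'' * y' * y ≡⟨ *-swap23 x'' y' y ⟩
    x'' * y * y' ∎)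
    where open ≤-Reasoning

  cross-≤-< : ∀ x y x' y' x'' y'' .{{_ : NonZero y}} → x * y' ≤ x' * y → x' * y'' < x'' * y' → x * y'' < x'' * y
  cross-≤-< x y x' y' x'' y'' p q = *-cancelʳ-< y' _ _ (begin-strict
    x * y'' * y' ≡⟨ *-swap23 x y'' y' ⟩
    x * y' * y'' ≤⟨ *-monoˡ-≤ y'' p ⟩
    x' * y * y'' ≡⟨ *-swap23 x' y y'' ⟩
    x' * y'' * y <⟨ *-monoˡ-< y q ⟩
    x'' * y' * y ≡⟨ *-swap23 x'' y' y ⟩
    x'' * y * y' ∎)
    where open ≤-Reasoning

≼-trans : ∀ {u v w} → u ≼ v → v ≼ w → u ≼ w
≼-trans {u} {v} {w} (≼⁺ p) (≼⁺ q) = ≼⁺ (cross-≤ (3 ^ co u) (arg u ^ 3) (3 ^ co v) (arg v ^ 3) (3 ^ co w) (arg w ^ 3) {{cube≢0 v}} p q)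

≺-≼-trans : ∀ {u v w} → u ≺ v → v ≼ w → u ≺ w
≺-≼-trans {u} {v} {w} (≺⁺ p) (≼⁺ q) = ≺⁺ (cross-<-≤ (3 ^ co u) (arg u ^ 3) (3 ^ co v) (arg v ^ 3) (3 ^ co w) (arg w ^ 3) {{cube≢0 w}} p q)

≼-≺-trans : ∀ {u v w} → u ≼ v → v ≺ w → u ≺ w
≼-≺-trans {u} {v} {w} (≼⁺ p) (≺⁺ q) = ≺⁺ (cross-≤-< (3 ^ co u) (arg u ^ 3) (3 ^ co v) (arg v ^ 3) (3 ^ co w) (arg w ^ 3) {{cube≢0 u}} p q)

≼-refl : ∀ {u} → u ≼ u
≼-refl = ≼⁺ ≤-refl

≺⇒≼ : ∀ {u v} → u ≺ v → u ≼ v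
≺⇒≼ (≺⁺ p) = ≼⁺ (<⇒≤ p)

≺-trans : ∀ {u v w} → u ≺ v → v ≺ w → u ≺ w
≺-trans p q = ≺-≼-trans p (≺⇒≼ q)

≃⇒≼ : ∀ {u v} → u ≃ v → u ≼ v
≃⇒≼ (≃⁺ p) = ≼⁺ (≤-reflexive p)

≃⇒≽ : ∀ {u v} → u ≃ v → v ≼ u
≃⇒≽ (≃⁺ p) = ≼⁺ (≤-reflexive (sym p))

≼-antisym : ∀ {u v} → u ≼ v → v ≼ u → u ≃ v
≼-antisym (≼⁺ p) (≼⁺ q) = ≃⁺ (≤-antisym p q)

≃-refl : ∀ {u} → u ≃ u
≃-refl = ≃⁺ refl

≃-sym : ∀ {u v} → u ≃ v → v ≃ u
≃-sym (≃⁺ p) = ≃⁺ (sym p)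

≃-trans : ∀ {u v w} → u ≃ v → v ≃ w → u ≃ w
≃-trans p q = ≼-antisym (≼-trans (≃⇒≼ p) (≃⇒≼ q)) (≼-trans (≃⇒≽ q) (≃⇒≽ p))

≺⇒⋡ : ∀ {u v} → u ≺ v → ¬ (v ≼ u)
≺⇒⋡ (≺⁺ p) (≼⁺ q) = <⇒≱ p q

≺⇒≄ : ∀ {u v} → u ≺ v → ¬ (u ≃ v)
≺⇒≄ p q = ≺⇒⋡ p (≃⇒≽ q)

opaque
  _≺?_ : ∀ u v → Dec (u ≺ v)
  u ≺? v = map′ ≺⁺ ≺⁻ (_ <? _)

  _≼?_ : ∀ u v → Dec (u ≼ v)
  u ≼? v = map′ ≼⁺ ≼⁻ (_ ≤? _)

≺-or-≽ : ∀ u v → u ≺ v ⊎ v ≼ u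
≺-or-≽ u v with u ≺? v
... | yes p = inj₁ p
... | no p = inj₂ (≼⁺ (≮⇒≥ (λ q → p (≺⁺ q))))

≼⇒≺⊎≃ : ∀ {u v} → u ≼ v → u ≺ v ⊎ u ≃ v
≼⇒≺⊎≃ (≼⁺ p) with m≤n⇒m<n∨m≡n p
... | inj₁ q = inj₁ (≺⁺ q)
... | inj₂ q = inj₂ (≃⁺ q)

up : V → V
up v = ⟨ suc (co v) , arg v ⟩

up-mono-≼ : ∀ {u v} → u ≼ v → up u ≼ up v
up-mono-≼ {u} {v} (≼⁺ p) = ≼⁺ (subst₂ _≤_ (sym (*-assoc 3 (3 ^ co u) _)) (sym (*-assoc 3 (3 ^ co v) _)) (*-monoʳ-≤ 3 p))

up-mono-≺ : ∀ {u v} → u ≺ v → up u ≺ up v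
up-mono-≺ {u} {v} (≺⁺ p) = ≺⁺ (subst₂ _<_ (sym (*-assoc 3 (3 ^ co u) _)) (sym (*-assoc 3 (3 ^ co v) _)) (*-monoʳ-< 3 p))

up-cong : ∀ {u v} → u ≃ v → up u ≃ up v
up-cong p = ≼-antisym (up-mono-≼ (≃⇒≼ p)) (up-mono-≼ (≃⇒≽ p))

up-cancel-≺ : ∀ {u v} → up u ≺ up v → u ≺ v
up-cancel-≺ {u} {v} p with ≺-or-≽ u v
... | inj₁ q = q
... | inj₂ q = ⊥-elim (≺⇒⋡ p (up-mono-≼ q))

up-cancel-≼ : ∀ {u v} → up u ≼ up v → u ≼ v
up-cancel-≼ {u} {v} p with ≺-or-≽ v u
... | inj₂ q = q
... | inj₁ q = ⊥-elim (≺⇒⋡ (up-mono-≺ q) p)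

up-cancel-≃ : ∀ {u v} → up u ≃ up v → u ≃ v
up-cancel-≃ p = ≼-antisym (up-cancel-≼ (≃⇒≼ p)) (up-cancel-≼ (≃⇒≽ p))

≺-up : ∀ {v} → v ≺ up v
≺-up {v} = ≺⁺ (*-monoˡ-< (arg v ^ 3) {{cube≢0 v}} (^-monoʳ-< 3 (s≤s (s≤s z≤n)) (n<1+n (co v))))

shift3 : ∀ c m .{{_ : NonZero m}} → ⟨ 3 + c , 3 * m ⟩ {{m*n≢0 3 m}} ≃ ⟨ c , m ⟩
shift3 c m = ≃⁺ (3^c*3 c m)

opaque
  -- Costs are natural numbers, so 1 is subtracted by adding 2 to the cost and tripling the number:
  -- the pair (3 , 3) has value 0.
  dn : V → V
  dn v = ⟨ 2 + co v , 3 * arg v ⟩ {{m*n≢0 3 (arg v)}}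

  up-dn : ∀ {v} → up (dn v) ≃ v
  up-dn {v} = shift3 (co v) (arg v)

dn-up : ∀ {v} → dn (up v) ≃ v
dn-up {v} = up-cancel-≃ up-dn

dn-mono-≼ : ∀ {u v} → u ≼ v → dn u ≼ dn v
dn-mono-≼ p = up-cancel-≼ (≼-trans (≃⇒≼ up-dn) (≼-trans p (≃⇒≽ up-dn)))

dn-mono-≺ : ∀ {u v} → u ≺ v → dn u ≺ dn v
dn-mono-≺ p = up-cancel-≺ (≼-≺-trans (≃⇒≼ up-dn) (≺-≼-trans p (≃⇒≽ up-dn)))

dn-cong : ∀ {u v} → u ≃ v → dn u ≃ dn v
dn-cong p = ≼-antisym (dn-mono-≼ (≃⇒≼ p)) (dn-mono-≼ (≃⇒≽ p))

≺-up⇒dn-≺ : ∀ {u v} → u ≺ up v → dn u ≺ v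
≺-up⇒dn-≺ p = ≺-≼-trans (dn-mono-≺ p) (≃⇒≼ dn-up)

≼-up⇒dn-≼ : ∀ {u v} → u ≼ up v → dn u ≼ v
≼-up⇒dn-≼ p = ≼-trans (dn-mono-≼ p) (≃⇒≼ dn-up)

up-≼⇒≼-dn : ∀ {u v} → up u ≼ v → u ≼ dn v
up-≼⇒≼-dn p = ≼-trans (≃⇒≽ dn-up) (dn-mono-≼ p)

up-≺⇒≺-dn : ∀ {u v} → up u ≺ v → u ≺ dn v
up-≺⇒≺-dn p = ≼-≺-trans (≃⇒≽ dn-up) (dn-mono-≺ p)

dn-≺⇒≺-up : ∀ {u v} → dn u ≺ v → u ≺ up v
dn-≺⇒≺-up p = ≼-≺-trans (≃⇒≽ up-dn) (up-mono-≺ p)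

3^≢0 : ∀ k → NonZero (3 ^ k)
3^≢0 k = m^n≢0 3 k

shift3^ : ∀ k c m .{{_ : NonZero m}} → ⟨ 3 * k + c , 3 ^ k * m ⟩ {{m*n≢0 (3 ^ k) m {{3^≢0 k}}}} ≃ ⟨ c , m ⟩
shift3^ k c m = ≃⁺ (begin
  3 ^ (3 * k + c) * m ^ 3 ≡⟨ cong (_* m ^ 3) (^-distribˡ-+-* 3 (3 * k) c) ⟩
  3 ^ (3 * k) * 3 ^ c * m ^ 3 ≡⟨ cong (λ x → x * 3 ^ c * m ^ 3) (trans (cong (3 ^_) (*-comm 3 k)) (sym (^-*-assoc 3 k 3))) ⟩
  (3 ^ k) ^ 3 * 3 ^ c * m ^ 3 ≡⟨ trans (*-swap23 ((3 ^ k) ^ 3) (3 ^ c) (m ^ 3)) (*-comm ((3 ^ k) ^ 3 * m ^ 3) (3 ^ c)) ⟩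
  3 ^ c * ((3 ^ k) ^ 3 * m ^ 3) ≡⟨ cong (3 ^ c *_) (cube-* (3 ^ k) m) ⟨
  3 ^ c * (3 ^ k * m) ^ 3 ∎)
  where open ≡-Reasoning

-- Values and powers of 3

prime3 : Prime 3
prime3 = from-yes (prime? 3)

3∣cube⇒3∣ : ∀ y → 3 ∣ y ^ 3 → 3 ∣ y
3∣cube⇒3∣ y p with euclidsLemma y (y * (y * 1)) prime3 p
... | inj₁ q = q
... | inj₂ q with euclidsLemma y (y * 1) prime3 q
... | inj₁ r = r
... | inj₂ r = subst (3 ∣_) (*-identityʳ y) r

cube-*3 : ∀ z → (z * 3) ^ 3 ≡ 3 * (9 * z ^ 3)
cube-*3 = lem
  where
  lem : ∀ z → (z * 3) * ((z * 3) * ((z * 3) * 1)) ≡ 3 * (9 * (z * (z * (z * 1))))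
  lem = solve-∀

cube-injective : ∀ m n → m ^ 3 ≡ n ^ 3 → m ≡ n
cube-injective m n p with <-cmp m n
... | tri≈ _ q _ = q
... | tri< q _ _ = ⊥-elim (<⇒≢ (^-monoˡ-< 3 q) p)
... | tri> _ _ q = ⊥-elim (<⇒≢ (^-monoˡ-< 3 q) (sym p))

cube-root-3 : ∀ x y z → x ^ 3 ≡ 3 * y → x ≡ z * 3 → 9 * z ^ 3 ≡ y
cube-root-3 x y z p refl = *-cancelˡ-≡ _ _ 3 (trans (sym (cube-*3 z)) p)

3∣root : ∀ x y → x ^ 3 ≡ 3 * y → 3 ∣ x
3∣root x y p = 3∣cube⇒3∣ x (divides y (trans p (*-comm 3 y)))

-- Infinite descent: neither 3 nor 9 is the cube of a rational.
3y³≢x³ : ∀ n x y .{{_ : NonZero y}} → x ≤ n → x ^ 3 ≢ 3 * y ^ 3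
9y³≢x³ : ∀ n x y .{{_ : NonZero y}} → x ≤ n → x ^ 3 ≢ 3 * (3 * y ^ 3)

3y³≢x³ zero zero y _ p = <⇒≢ (*-monoʳ-< 3 (m^n>0 y 3)) p
3y³≢x³ (suc n) x y x≤n p with 3∣root x (y ^ 3) p
... | divides zero refl = <⇒≢ (*-monoʳ-< 3 (m^n>0 y 3)) p
... | divides z@(suc _) q = 9y³≢x³ n y z (s≤s⁻¹ (<-≤-trans y<x x≤n)) (trans (sym (cube-root-3 x (y ^ 3) z p q)) (*-assoc 3 3 (z ^ 3)))
  where
  y<x : y < x
  y<x = ≰⇒> λ r → <⇒≱ (m<m*n (y ^ 3) 3 {{m^n≢0 y 3}} (s≤s (s≤s z≤n))) (≤-trans (≤-reflexive (trans (*-comm (y ^ 3) 3) (sym p))) (cube-mono r))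
9y³≢x³ zero zero y _ p = <⇒≢ (*-monoʳ-< 3 (*-monoʳ-< 3 (m^n>0 y 3))) p
9y³≢x³ (suc n) x y x≤n p with 3∣root x (3 * y ^ 3) p
... | divides zero refl = <⇒≢ (*-monoʳ-< 3 (*-monoʳ-< 3 (m^n>0 y 3))) p
... | divides z@(suc _) q = 3y³≢x³ n y z (s≤s⁻¹ (<-≤-trans y<x x≤n))
    (sym (*-cancelˡ-≡ _ _ 3 (trans (sym (*-assoc 3 3 (z ^ 3))) (cube-root-3 x (3 * y ^ 3) z p q))))
  where
  y<x : y < x
  y<x = ≰⇒> λ r → <⇒≱ (m<m*n (y ^ 3) 9 {{m^n≢0 y 3}} (s≤s (s≤s z≤n)))
    (≤-trans (≤-reflexive (trans (*-comm (y ^ 3) 9) (trans (*-assoc 3 3 (y ^ 3)) (sym p)))) (cube-mono r))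

-- As 27 is a cube, `d` can be lowered by 3 at a time; a remainder 1 or 2 would make 3 or 9 the cube
-- of a rational.
cube-root-3^ : ∀ d x y .{{_ : NonZero y}} → x ^ 3 ≡ 3 ^ d * y ^ 3 → ∃[ q ] d ≡ 3 * q × x ≡ 3 ^ q * y
cube-root-3^ 0 x y p = 0 , refl , trans (cube-injective x y (trans p (*-identityˡ (y ^ 3)))) (sym (*-identityˡ y))
cube-root-3^ 1 x y p = ⊥-elim (3y³≢x³ x x y ≤-refl p)
cube-root-3^ 2 x y p = ⊥-elim (9y³≢x³ x x y ≤-refl (trans p (*-assoc 3 3 (y ^ 3))))
cube-root-3^ (suc (suc (suc d))) x y p with 3∣root x (3 ^ (2 + d) * y ^ 3) (trans p (*-assoc 3 (3 ^ (2 + d)) (y ^ 3)))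
... | divides z q with cube-root-3^ d z y (*-cancelˡ-≡ _ _ 9 (trans (cube-root-3 x (3 ^ (2 + d) * y ^ 3) z (trans p (*-assoc 3 (3 ^ (2 + d)) (y ^ 3))) q)
    (lem (3 ^ d) (y ^ 3))))
  where
  lem : ∀ a b → 3 * (3 * a) * b ≡ 9 * (a * b)
  lem = solve-∀
... | r , s , t = suc r , trans (cong (3 +_) s) (sym (*-suc 3 r)) , trans q (trans (cong (_* 3) t) (trans (*-comm (3 ^ r * y) 3) (sym (*-assoc 3 (3 ^ r) y))))

-- Equal values mean that a power of 3 is a ratio of two cubes, hence the cube of a power of 3. So a
-- value determines its pair up to trading a factor 3 against a cost of 3, and this is how numbers
-- and costs are recovered from values.
≃⇒3^ : ∀ {u v} → u ≃ v → ∃[ s ] ∃[ t ] 3 ^ s * arg u ≡ 3 ^ t * arg v × co u + 3 * s ≡ co v + 3 * t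
≃⇒3^ {u} {v} (≃⁺ p) with ≤-total (co u) (co v)
... | inj₁ q = lem q p
  where
  lem : co u ≤ co v → 3 ^ co u * arg v ^ 3 ≡ 3 ^ co v * arg u ^ 3 → ∃[ s ] ∃[ t ] 3 ^ s * arg u ≡ 3 ^ t * arg v × co u + 3 * s ≡ co v + 3 * t
  lem q p with cube-root-3^ (co v ∸ co u) (arg v) (arg u) (*-cancelˡ-≡ _ _ (3 ^ co u) {{3^≢0 (co u)}} (trans p
     (trans (cong (λ x → 3 ^ x * arg u ^ 3) (sym (m+[n∸m]≡n q))) (trans (cong (_* arg u ^ 3) (^-distribˡ-+-* 3 (co u) (co v ∸ co u))) (*-assoc (3 ^ co u) _ _)))))
  ... | s , r , t = s , 0 , trans (sym t) (sym (*-identityˡ (arg v))) , trans (cong (co u +_) (sym r)) (trans (m+[n∸m]≡n q) (sym (+-identityʳ (co v))))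
... | inj₂ q with cube-root-3^ (co u ∸ co v) (arg u) (arg v) (*-cancelˡ-≡ _ _ (3 ^ co v) {{3^≢0 (co v)}} (trans (sym p)
     (trans (cong (λ x → 3 ^ x * arg v ^ 3) (sym (m+[n∸m]≡n q))) (trans (cong (_* arg v ^ 3) (^-distribˡ-+-* 3 (co v) (co u ∸ co v))) (*-assoc (3 ^ co v) _ _)))))
... | t , r , e = 0 , t , trans (*-identityˡ (arg u)) e , trans (+-identityʳ (co u)) (trans (sym (m+[n∸m]≡n q)) (cong (co v +_) r))

-- Classes of costs and the closed set `C`.

-- A value fixes its cost only modulo 3, hence the closure under 3. The two halves of the theorem
-- are the instances `all` and `residue`.
record Class : Set₁ where
  field
    holds : ℕ → Set
    holds? : ∀ c → Dec (holds c)
    +3⁺ : ∀ {c} → holds c → holds (3 + c)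
    +3⁻ : ∀ {c} → holds (3 + c) → holds c
open Class public

all : Class
all = record { holds = λ _ → ⊤ ; holds? = λ _ → yes tt ; +3⁺ = id ; +3⁻ = id }

prev : Class → Class
prev P = record { holds = λ c → holds P (suc c) ; holds? = λ c → holds? P (suc c) ; +3⁺ = +3⁺ P ; +3⁻ = +3⁻ P }

+3*⁺ : ∀ P s {c} → holds P c → holds P (c + 3 * s)
+3*⁺ P zero p = subst (holds P) (sym (+-identityʳ _)) p
+3*⁺ P (suc s) {c} p = subst (holds P) (lem c s) (+3⁺ P (+3*⁺ P s p))
  where
  lem : ∀ c s → 3 + (c + 3 * s) ≡ c + 3 * suc s
  lem = solve-∀

+3*⁻ : ∀ P s {c} → holds P (c + 3 * s) → holds P c
+3*⁻ P zero p = subst (holds P) (+-identityʳ _) p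
+3*⁻ P (suc s) {c} p = +3*⁻ P s (+3⁻ P (subst (holds P) (sym (lem c s)) p))
  where
  lem : ∀ c s → 3 + (c + 3 * s) ≡ c + 3 * suc s
  lem = solve-∀

holds-≃ : ∀ P {u v} → u ≃ v → holds P (co u) → holds P (co v)
holds-≃ P p h with ≃⇒3^ p
... | s , t , _ , q = +3*⁻ P t (subst (holds P) q (+3*⁺ P s h))

val : Expr → V
val e = ⟨ size e , eval e ⟩ {{eval-nonZero e}}

val₊ : Expr → ℕ → V
val₊ e j = ⟨ size e + j , eval e ⟩ {{eval-nonZero e}}

-- The topological closure of the set of defects of stable numbers, in the class P.
record C (P : Class) (z : V) : Set where
  constructor mkC
  field
    expr : Expr
    slack : ℕ
    class : holds P (size expr + slack)
    eq : z ≃ val₊ expr slack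

C-resp : ∀ {P z z'} → z ≃ z' → C P z → C P z'
C-resp p (mkC e j h q) = mkC e j h (≃-trans (≃-sym p) q)

coord-≡ : ∀ {c c' m m'} .{{_ : NonZero m}} .{{_ : NonZero m'}} → c ≡ c' → m ≡ m' → ⟨ c , m ⟩ ≃ ⟨ c' , m' ⟩
coord-≡ refl refl = ≃-refl

C-up : ∀ {P z} → C (prev P) z → C P (up z)
C-up {P} (mkC e j h q) = mkC e (suc j) (subst (holds P) (sym (+-suc (size e) j)) h)
  (≃-trans (up-cong q) (coord-≡ {{eval-nonZero e}} {{eval-nonZero e}} (sym (+-suc (size e) j)) refl))

C-all : ∀ {P z} → C P z → C all z
C-all (mkC e j _ q) = mkC e j tt q

C-val : ∀ {P} e → holds P (size e) → C P (val e)
C-val {P} e h = mkC e 0 (subst (holds P) (sym (+-identityʳ _)) h) (coord-≡ {{eval-nonZero e}} {{eval-nonZero e}} (sym (+-identityʳ _)) refl)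

-- A unit of slack can be given up, which lowers the value by 1 and leads to the previous class.
-- Knowledge of `C (prev P)` thus settles all points of `C P` except the values of expressions.
C-val⁻ : ∀ {P z} → C P z → (∃[ e ] holds P (size e) × z ≃ val e) ⊎ C (prev P) (dn z)
C-val⁻ {P} (mkC e zero h q) = inj₁ (e , subst (holds P) (+-identityʳ _) h ,
  ≃-trans q (coord-≡ {{eval-nonZero e}} {{eval-nonZero e}} (+-identityʳ _) refl))
C-val⁻ {P} (mkC e (suc j) h q) = inj₂ (mkC e j (subst (holds P) (+-suc (size e) j) h)
  (≃-trans (dn-cong (≃-trans q (coord-≡ {{eval-nonZero e}} {{eval-nonZero e}} (+-suc (size e) j) refl))) dn-up))

𝟎 : V
𝟎 = ⟨ 0 , 1 ⟩

C-nonneg : ∀ {P z} → C P z → 𝟎 ≼ z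
C-nonneg (mkC e j _ q) = ≼-trans {v = val₊ e j} (≼⁺ (≤-trans (≤-reflexive (*-identityˡ (eval e ^ 3)))
  (≤-trans (eval³≤3^size e) (≤-trans (^-monoʳ-≤ 3 (m≤m+n (size e) j)) (≤-reflexive (sym (*-identityʳ _)))))))
  (≃⇒≽ q)

-- The central estimate.

≺-arg : ∀ {c c' m m'} .{{_ : NonZero m}} .{{_ : NonZero m'}} → c ≡ c' → m' < m → ⟨ c , m ⟩ ≺ ⟨ c' , m' ⟩
≺-arg {c} refl p = ≺⁺ (*-monoʳ-< (3 ^ c) {{3^≢0 c}} (^-monoˡ-< 3 p))

n<3^n : ∀ n → n < 3 ^ n
n<3^n zero = s≤s z≤n
n<3^n (suc n) = ≤-trans (+-mono-≤ (m^n>0 3 n) (n<3^n n)) (+-monoʳ-≤ (3 ^ n) (m≤m+n (3 ^ n) _))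

m≤m³ : ∀ m → m ≤ m ^ 3
m≤m³ zero = z≤n
m≤m³ m@(suc _) = m≤m*n m (m ^ 2) {{m^n≢0 m 2}}

-- Since Y ≥ X + 1, the hypothesis makes X ((A + B)³ - A³) at least A³, while for B ≤ A the
-- difference of cubes is at most 7 A² B.
large-summand-bound : ∀ X Y A B .{{_ : NonZero A}} → B ≤ A → X < Y → Y * A ^ 3 ≤ X * (A + B) ^ 3 → A ≤ 7 * X * B
large-summand-bound X Y A B B≤A X<Y p = *-cancelˡ-≤ (A * A) {{m*n≢0 A A}} (+-cancelʳ-≤ (X * A ^ 3) _ _ (begin
  A * A * A + X * A ^ 3 ≡⟨ lem A X ⟩
  suc X * A ^ 3 ≤⟨ *-monoˡ-≤ (A ^ 3) X<Y ⟩
  Y * A ^ 3 ≤⟨ p ⟩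
  X * (A + B) ^ 3 ≤⟨ *-monoʳ-≤ X (cube-+-≤ B≤A) ⟩
  X * (A ^ 3 + 7 * (A * A * B)) ≡⟨ lem₂ X (A ^ 3) (A * A) B ⟩
  A * A * (7 * X * B) + X * A ^ 3 ∎))
  where
  open ≤-Reasoning
  lem : ∀ A X → A * A * A + X * (A * (A * (A * 1))) ≡ suc X * (A * (A * (A * 1)))
  lem = solve-∀
  lem₂ : ∀ X a a² B → X * (a + 7 * (a² * B)) ≡ a² * (7 * X * B) + X * a
  lem₂ = solve-∀

-- This is 1 + n/U ≤ (1 + 1/U)^n with the denominators cleared.
bernoulli : ∀ U n → (n + U) * U ^ n ≤ U * suc U ^ n
bernoulli U zero = ≤-refl
bernoulli U (suc n) = begin
  (suc n + U) * (U * U ^ n) ≤⟨ m≤m+n _ (n * U ^ n) ⟩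
  (suc n + U) * (U * U ^ n) + n * U ^ n ≡⟨ lem n U (U ^ n) ⟩
  suc U * ((n + U) * U ^ n) ≤⟨ *-monoʳ-≤ (suc U) (bernoulli U n) ⟩
  suc U * (U * suc U ^ n) ≡⟨ lem₂ (suc U) U (suc U ^ n) ⟩
  U * (suc U * suc U ^ n) ∎
  where
  open ≤-Reasoning
  lem : ∀ n U x → (suc n + U) * (U * x) + n * x ≡ suc U * ((n + U) * x)
  lem = solve-∀
  lem₂ : ∀ a b c → a * (b * c) ≡ b * (a * c)
  lem₂ = solve-∀

-- `Exc` describes the points of `C (prev P)` between `w` and `σ`; expressions with values above
-- `w + 1` and up to `v` are treated. Strictness of `v ≺ up σ` supplies the integer gap from which
-- the bounds come. `Exc` is empty in the induction on the cost, and the single point δ(n) in the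
-- comparison of the two sets.
module Cover (P : Class) (w σ v : V) (v≺σ+1 : v ≺ up σ) (Exc : V → Set)
             (exc : ∀ z → C (prev P) z → w ≺ z → z ≺ σ → Exc z) where

  record Exceptional (N : ℕ) : Set where
    constructor mkExc
    field
      left right rest : Expr
      eval-≡ : (eval left + eval right) * eval rest ≡ N
      value : Exc (val₊ (left ⊗ rest) (pred (size right)))

  -- The 8 is 2³, from a + b ≤ 2a for the larger summand a. `X` is the smaller side of the
  -- inequality that `v ≺ up σ` unfolds to.
  K X : ℕ
  K = 3 ^ co v * 8
  X = 3 ^ co v * arg σ ^ 3

  opaque
    -- `G` adds up the bounds for the two summands found in `sum-bound`. A leaf of size at most `G`
    -- and of positive value has eval³ ≤ 3^size - 1, so eval³ / 3^size is at most U / (U + 1).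
    G U : ℕ
    G = suc (3 ^ co v * (8 * (7 * X * K) ^ 3) + K)
    U = pred (3 ^ G)

    B : ℕ
    -- By `leaf-count` at most `U * 3 ^ co v` leaves remain, each of size at most `G`; the 3 is the
    -- size of the factor `three`.
    B = 3 + (U * 3 ^ co v) * G

    B-bound : ∀ {n} → n ≤ U * 3 ^ co v → 3 + n * G ≤ B
    B-bound p = +-monoʳ-≤ 3 (*-monoˡ-≤ G p)

    G-bound : 3 ^ co v * (8 * (7 * X * K) ^ 3) + K ≤ G
    G-bound = n≤1+n _

    1≤G : 1 ≤ G
    1≤G = s≤s z≤n

    3^G≡1+U : 3 ^ G ≡ suc U
    3^G≡1+U = sym (suc-pred (3 ^ G) {{3^≢0 G}})

  U≢0 : NonZero U
  U≢0 = >-nonZero (s≤s⁻¹ (≤-trans (s≤s (s≤s z≤n)) (≤-trans (^-monoʳ-≤ 3 {1} 1≤G) (≤-reflexive 3^G≡1+U))))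

  -- `M` is the cube of the whole number. The part of cost `s₂` contributes at most 3^s₂ to it, so
  -- the cost `s₁` has to be covered by `Q` and by the room that `v` leaves.
  factor-size-bound : ∀ s₁ s₂ M Q → 3 ^ (s₁ + s₂) * arg v ^ 3 ≤ 3 ^ co v * M → M ≤ Q * 3 ^ s₂ → 3 ^ s₁ ≤ 3 ^ co v * Q
  factor-size-bound s₁ s₂ M Q p q = *-cancelʳ-≤ _ _ (3 ^ s₂) {{3^≢0 s₂}} (begin
    3 ^ s₁ * 3 ^ s₂ ≡⟨ ^-distribˡ-+-* 3 s₁ s₂ ⟨
    3 ^ (s₁ + s₂) ≤⟨ m≤m*n _ (arg v ^ 3) {{m^n≢0 (arg v) 3}} ⟩
    3 ^ (s₁ + s₂) * arg v ^ 3 ≤⟨ p ⟩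
    3 ^ co v * M ≤⟨ *-monoʳ-≤ (3 ^ co v) q ⟩
    3 ^ co v * (Q * 3 ^ s₂) ≡⟨ *-assoc (3 ^ co v) Q (3 ^ s₂) ⟨
    3 ^ co v * Q * 3 ^ s₂ ∎)
    where open ≤-Reasoning

  module _ {N S : ℕ} .{{_ : NonZero N}} (w+1≺z : up w ≺ ⟨ S , N ⟩) (z≼v : ⟨ S , N ⟩ ≼ v) (class : holds P S) where

    -- Drop the smaller summand `b`, but keep its cost except 1 as slack: this gives a point z' of
    -- `C (prev P)` with z < z' + 1, so z' > w. If z' < σ, then `exc` applies. Otherwise z' + 1 ≥ σ
    -- + 1 > v ≥ z, so dropping `b` changes the number by a definite ratio, and `a` is at most a
    -- constant times `b`. And `b` is small: it at most doubles the sum, so nearly all of its cost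
    -- goes into the value, which `v` bounds.
    sum-bound : ∀ a b r → eval b ≤ eval a → (eval a + eval b) * eval r ≡ N → size a + size b + size r ≡ S →
                size (a ⊕ b) ≤ G ⊎ Exc (val₊ (a ⊗ r) (pred (size b)))
    sum-bound a b r b≤a refl refl with ≺-or-≽ (val₊ (a ⊗ r) (pred (size b))) σ
    ... | inj₁ z'≺σ = inj₂ (exc _ (mkC (a ⊗ r) (pred (size b)) (subst (holds P) sizes class) ≃-refl)
                              (up-cancel-≺ (≺-trans w+1≺z z≺z'+1)) z'≺σ)
      where
      sizes : size a + size b + size r ≡ suc (size a + size r + pred (size b))
      sizes = trans (cong (λ s → size a + s + size r) (sym (suc-pred (size b) {{>-nonZero (size>0 b)}}))) (lem (size a) (pred (size b)) (size r))
        where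
        lem : ∀ a b r → a + suc b + r ≡ suc (a + r + b)
        lem = solve-∀
      z≺z'+1 : ⟨ S , N ⟩ ≺ up (val₊ (a ⊗ r) (pred (size b)))
      z≺z'+1 = ≺-arg {{_}} {{eval-nonZero (a ⊗ r)}} sizes (*-monoˡ-< (eval r) {{eval-nonZero r}} (m<m+n (eval a) (>-nonZero⁻¹ _ {{eval-nonZero b}})))
    ... | inj₂ (≼⁺ σ≼z') = inj₁ (≤-trans (+-mono-≤ size-a size-b) G-bound)
      where
      A = eval a
      B' = eval b
      R = eval r
      S' = size a + size r + pred (size b)
      instance
        A≢0 : NonZero A
        A≢0 = eval-nonZero a
        R≢0 : NonZero R
        R≢0 = eval-nonZero r
      sizes : 3 ^ (size a + size b + size r) ≡ 3 * 3 ^ S'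
      sizes = cong (3 ^_) (trans (cong (λ s → size a + s + size r) (sym (suc-pred (size b) {{>-nonZero (size>0 b)}}))) (lem (size a) (pred (size b)) (size r)))
        where
        lem : ∀ a b r → a + suc b + r ≡ suc (a + r + b)
        lem = solve-∀
      sum³ : ((A + B') * R) ^ 3 ≤ 8 * (A ^ 3 * R ^ 3)
      sum³ = begin
        ((A + B') * R) ^ 3 ≤⟨ cube-mono (*-monoˡ-≤ R (≤-trans (+-monoʳ-≤ A b≤a) (≤-reflexive (lem A)))) ⟩
        ((2 * A) * R) ^ 3 ≡⟨ trans (cube-* (2 * A) R) (trans (cong (_* R ^ 3) (cube-* 2 A)) (*-assoc 8 (A ^ 3) (R ^ 3))) ⟩
        8 * (A ^ 3 * R ^ 3) ∎
        where
        open ≤-Reasoning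
        lem : ∀ A → A + A ≡ 2 * A
        lem = solve-∀
      3^size-b : 3 ^ size b ≤ K
      3^size-b = factor-size-bound (size b) (size a + size r) (((A + B') * R) ^ 3) 8
        (subst (λ s → 3 ^ s * arg v ^ 3 ≤ 3 ^ co v * ((A + B') * R) ^ 3) (lem (size a) (size b) (size r)) (≼⁻ z≼v))
        (≤-trans sum³ (*-monoʳ-≤ 8 (≤-trans (*-mono-≤ (eval³≤3^size a) (eval³≤3^size r)) (≤-reflexive (sym (^-distribˡ-+-* 3 (size a) (size r)))))))
        where
        lem : ∀ a b r → a + b + r ≡ b + (a + r)
        lem = solve-∀
      size-b : size b ≤ K
      size-b = ≤-trans (<⇒≤ (n<3^n (size b))) 3^size-b
      A≤7XB : A ≤ 7 * X * B'
      A≤7XB = large-summand-bound X (3 ^ suc (co σ) * arg v ^ 3) A B' b≤a (≺⁻ v≺σ+1)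
        (*-cancelʳ-≤ _ _ (3 ^ S' * R ^ 3) {{m*n≢0 (3 ^ S') (R ^ 3) {{3^≢0 S'}} {{m^n≢0 R 3}}}} (begin
          3 ^ suc (co σ) * arg v ^ 3 * A ^ 3 * (3 ^ S' * R ^ 3) ≡⟨ lem (3 ^ co σ) (arg v ^ 3) (A ^ 3) (3 ^ S') (R ^ 3) ⟩
          (3 ^ co σ * (A ^ 3 * R ^ 3)) * (3 * 3 ^ S' * arg v ^ 3) ≡⟨ cong₂ (λ x y → 3 ^ co σ * x * (y * arg v ^ 3)) (cube-* A R) sizes ⟨
          (3 ^ co σ * (A * R) ^ 3) * (3 ^ (size a + size b + size r) * arg v ^ 3) ≤⟨ *-mono-≤ σ≼z' (≼⁻ z≼v) ⟩
          (3 ^ S' * arg σ ^ 3) * (3 ^ co v * ((A + B') * R) ^ 3) ≡⟨ cong (λ x → 3 ^ S' * arg σ ^ 3 * (3 ^ co v * x)) (cube-* (A + B') R) ⟩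
          (3 ^ S' * arg σ ^ 3) * (3 ^ co v * ((A + B') ^ 3 * R ^ 3)) ≡⟨ lem₂ (3 ^ S') (arg σ ^ 3) (3 ^ co v) ((A + B') ^ 3) (R ^ 3) ⟩
          X * (A + B') ^ 3 * (3 ^ S' * R ^ 3) ∎))
        where
        open ≤-Reasoning
        lem : ∀ s v a t r → 3 * s * v * a * (t * r) ≡ (s * (a * r)) * (3 * t * v)
        lem = solve-∀
        lem₂ : ∀ t s c x r → (t * s) * (c * (x * r)) ≡ c * s * x * (t * r)
        lem₂ = solve-∀
      A≤7XK : A ≤ 7 * X * K
      A≤7XK = ≤-trans A≤7XB (*-monoʳ-≤ (7 * X) (≤-trans (m≤m³ B') (≤-trans (eval³≤3^size b) 3^size-b)))
      size-a : size a ≤ 3 ^ co v * (8 * (7 * X * K) ^ 3)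
      size-a = ≤-trans (<⇒≤ (n<3^n (size a))) (≤-trans
        (factor-size-bound (size a) (size b + size r) (((A + B') * R) ^ 3) (8 * A ^ 3)
          (subst (λ s → 3 ^ s * arg v ^ 3 ≤ 3 ^ co v * ((A + B') * R) ^ 3) (+-assoc (size a) (size b) (size r)) (≼⁻ z≼v))
          (≤-trans sum³ (≤-trans (≤-reflexive (sym (*-assoc 8 (A ^ 3) (R ^ 3))))
            (*-monoʳ-≤ (8 * A ^ 3) (≤-trans (eval³≤3^size r) (^-monoʳ-≤ 3 (m≤n+m (size r) (size b))))))))
        (*-monoʳ-≤ (3 ^ co v) (*-monoʳ-≤ 8 (cube-mono A≤7XK))))

  data Bounded : Expr → Set where
    leaf : ∀ {e} → size e ≤ G → Bounded e
    _⊗ᵇ_ : ∀ {e f} → Bounded e → Bounded f → Bounded (e ⊗ f)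

  module _ {N S : ℕ} .{{_ : NonZero N}} (w+1≺z : up w ≺ ⟨ S , N ⟩) (z≼v : ⟨ S , N ⟩ ≼ v) (class : holds P S) where

    -- Only the value of the whole product is bounded, so each factor is examined with all the
    -- others collected in the cofactor `r`.
    bounded-or-exceptional : ∀ e r → eval e * eval r ≡ N → size e + size r ≡ S → Bounded e ⊎ Exceptional N
    bounded-or-exceptional one r p q = inj₁ (leaf 1≤G)
    bounded-or-exceptional (a ⊕ b) r p q with ≤-total (eval b) (eval a)
    ... | inj₁ b≤a with sum-bound w+1≺z z≼v class a b r b≤a p q
    ... | inj₁ h = inj₁ (leaf h)
    ... | inj₂ h = inj₂ (mkExc a b r p h)
    bounded-or-exceptional (a ⊕ b) r p q | inj₂ a≤b
      with sum-bound w+1≺z z≼v class b a r a≤b (trans (cong (_* eval r) (+-comm (eval b) (eval a))) p) (trans (cong (_+ size r) (+-comm (size b) (size a))) q)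
    ... | inj₁ h = inj₁ (leaf (≤-trans (≤-reflexive (+-comm (size a) (size b))) h))
    ... | inj₂ h = inj₂ (mkExc b a r (trans (cong (_* eval r) (+-comm (eval b) (eval a))) p) h)
    bounded-or-exceptional (e ⊗ f) r p q
      with bounded-or-exceptional e (f ⊗ r) (trans (sym (*-assoc (eval e) (eval f) (eval r))) p) (trans (sym (+-assoc (size e) (size f) (size r))) q)
         | bounded-or-exceptional f (e ⊗ r) (trans (lem (eval e) (eval f) (eval r)) p) (trans (lem₂ (size e) (size f) (size r)) q)
      where
      lem : ∀ e f r → f * (e * r) ≡ e * f * r
      lem = solve-∀
      lem₂ : ∀ e f r → f + (e + r) ≡ e + f + r
      lem₂ = solve-∀
    ... | inj₂ h | _ = inj₂ h
    ... | inj₁ _ | inj₂ h = inj₂ h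
    ... | inj₁ g | inj₁ h = inj₁ (g ⊗ᵇ h)

  val-⊗-cong : ∀ e {f g} → val f ≃ val g → val (e ⊗ f) ≃ val (e ⊗ g)
  val-⊗-cong e {f} {g} (≃⁺ p) = ≃⁺ (begin
    3 ^ (size e + size f) * (eval e * eval g) ^ 3 ≡⟨ cong₂ _*_ (^-distribˡ-+-* 3 (size e) (size f)) (cube-* (eval e) (eval g)) ⟩
    3 ^ size e * 3 ^ size f * (eval e ^ 3 * eval g ^ 3) ≡⟨ lem (3 ^ size e) (3 ^ size f) (eval e ^ 3) (eval g ^ 3) ⟩
    3 ^ size e * eval e ^ 3 * (3 ^ size f * eval g ^ 3) ≡⟨ cong (3 ^ size e * eval e ^ 3 *_) p ⟩
    3 ^ size e * eval e ^ 3 * (3 ^ size g * eval f ^ 3) ≡⟨ lem (3 ^ size e) (3 ^ size g) (eval e ^ 3) (eval f ^ 3) ⟨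
    3 ^ size e * 3 ^ size g * (eval e ^ 3 * eval f ^ 3) ≡⟨ cong₂ _*_ (^-distribˡ-+-* 3 (size e) (size g)) (cube-* (eval e) (eval f)) ⟨
    3 ^ (size e + size g) * (eval e * eval f) ^ 3 ∎)
    where
    open ≡-Reasoning
    lem : ∀ a b c d → a * b * (c * d) ≡ a * c * (b * d)
    lem = solve-∀

  val-⊗-zero : ∀ e f → eval e ^ 3 ≡ 3 ^ size e → val f ≃ val (e ⊗ f)
  val-⊗-zero e f p = ≃⁺ (begin
    3 ^ size f * (eval e * eval f) ^ 3 ≡⟨ cong (3 ^ size f *_) (trans (cube-* (eval e) (eval f)) (cong (_* eval f ^ 3) p)) ⟩
    3 ^ size f * (3 ^ size e * eval f ^ 3) ≡⟨ lem (3 ^ size e) (3 ^ size f) (eval f ^ 3) ⟩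
    3 ^ size e * 3 ^ size f * eval f ^ 3 ≡⟨ cong (_* eval f ^ 3) (^-distribˡ-+-* 3 (size e) (size f)) ⟨
    3 ^ (size e + size f) * eval f ^ 3 ∎)
    where
    open ≡-Reasoning
    lem : ∀ a b c → b * (a * c) ≡ a * b * c
    lem = solve-∀

  -- The leaves of value 0 are dropped. The others have value at least 3 log₃ (3^G / U), so their number n is bounded.
  reduce : ∀ {e} → Bounded e → ∀ acc → ∃[ n ] ∃[ e' ] val e' ≃ val (e ⊗ acc) × size e' ≤ size acc + n * G ×
           (suc U) ^ n * eval e ^ 3 ≤ U ^ n * 3 ^ size e
  reduce {e} (leaf h) acc with m≤n⇒m<n∨m≡n (eval³≤3^size e)
  ... | inj₂ p = 0 , acc , val-⊗-zero e acc p , m≤m+n (size acc) 0 , *-monoʳ-≤ 1 (eval³≤3^size e)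
  ... | inj₁ p = 1 , e ⊗ acc , ≃-refl , ≤-trans (+-monoˡ-≤ (size acc) h) (≤-reflexive (lem G (size acc))) , (begin
      suc U * 1 * eval e ^ 3 ≡⟨ lem₂ U (eval e ^ 3) ⟩
      eval e ^ 3 + U * eval e ^ 3 ≤⟨ +-monoˡ-≤ _ (s≤s⁻¹ (<-≤-trans p (≤-trans (^-monoʳ-≤ 3 h) (≤-reflexive 3^G≡1+U)))) ⟩
      U + U * eval e ^ 3 ≡⟨ lem₃ U (eval e ^ 3) ⟩
      U * 1 * suc (eval e ^ 3) ≤⟨ *-monoʳ-≤ (U * 1) p ⟩
      U * 1 * 3 ^ size e ∎)
    where
    open ≤-Reasoning
    lem : ∀ g a → g + a ≡ a + (g + 0)
    lem = solve-∀
    lem₂ : ∀ u x → suc u * 1 * x ≡ x + u * x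
    lem₂ = solve-∀
    lem₃ : ∀ u x → u + u * x ≡ u * 1 * suc x
    lem₃ = solve-∀
  reduce (_⊗ᵇ_ {e} {f} g h) acc with reduce h acc
  ... | n , f' , p , q , r with reduce g f'
  ... | m , e' , s , t , u = m + n , e' ,
      ≃-trans s (≃-trans (val-⊗-cong e {f'} {f ⊗ acc} p) (coord-≡ {{eval-nonZero (e ⊗ (f ⊗ acc))}} {{eval-nonZero ((e ⊗ f) ⊗ acc)}}
        (sym (+-assoc (size e) (size f) (size acc))) (sym (*-assoc (eval e) (eval f) (eval acc))))) ,
      ≤-trans t (≤-trans (+-monoˡ-≤ (m * G) q) (≤-reflexive (lem₁ (size acc) n m G))) , (begin
      suc U ^ (m + n) * (eval e * eval f) ^ 3 ≡⟨ cong₂ _*_ (^-distribˡ-+-* (suc U) m n) (cube-* (eval e) (eval f)) ⟩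
      suc U ^ m * suc U ^ n * (eval e ^ 3 * eval f ^ 3) ≡⟨ lem (suc U ^ m) (suc U ^ n) (eval e ^ 3) (eval f ^ 3) ⟩
      suc U ^ m * eval e ^ 3 * (suc U ^ n * eval f ^ 3) ≤⟨ *-mono-≤ u r ⟩
      U ^ m * 3 ^ size e * (U ^ n * 3 ^ size f) ≡⟨ lem (U ^ m) (U ^ n) (3 ^ size e) (3 ^ size f) ⟨
      U ^ m * U ^ n * (3 ^ size e * 3 ^ size f) ≡⟨ cong₂ _*_ (^-distribˡ-+-* U m n) (^-distribˡ-+-* 3 (size e) (size f)) ⟨
      U ^ (m + n) * 3 ^ (size e + size f) ∎)
    where
    open ≤-Reasoning
    lem : ∀ a b c d → a * b * (c * d) ≡ a * c * (b * d)
    lem = solve-∀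
    lem₁ : ∀ a n m g → a + n * g + m * g ≡ a + (m + n) * g
    lem₁ = solve-∀

  -- Each leaf kept raises 3^size / eval³ by a factor of at least (U + 1) / U, and `v` bounds this
  -- ratio by `3 ^ co v`; Bernoulli's inequality then bounds `n`.
  leaf-count : ∀ n e → val e ≼ v → (suc U) ^ n * eval e ^ 3 ≤ U ^ n * 3 ^ size e → n ≤ U * 3 ^ co v
  leaf-count n e (≼⁺ p) q = ≤-trans (m≤m+n n U) (*-cancelʳ-≤ _ _ (U ^ n) {{m^n≢0 U n {{U≢0}}}} (begin
    (n + U) * U ^ n ≤⟨ bernoulli U n ⟩
    U * suc U ^ n ≤⟨ *-monoʳ-≤ U ratio ⟩
    U * (U ^ n * 3 ^ co v) ≡⟨ lem U (U ^ n) (3 ^ co v) ⟩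
    U * 3 ^ co v * U ^ n ∎))
    where
    open ≤-Reasoning
    lem : ∀ u x c → u * (x * c) ≡ u * c * x
    lem = solve-∀
    E = eval e ^ 3
    ratio : suc U ^ n ≤ U ^ n * 3 ^ co v
    ratio = *-cancelʳ-≤ _ _ E {{m^n≢0 (eval e) 3 {{eval-nonZero e}}}} (begin
      suc U ^ n * E ≤⟨ q ⟩
      U ^ n * 3 ^ size e ≤⟨ *-monoʳ-≤ (U ^ n) (m≤m*n _ (arg v ^ 3) {{m^n≢0 (arg v) 3}}) ⟩
      U ^ n * (3 ^ size e * arg v ^ 3) ≤⟨ *-monoʳ-≤ (U ^ n) p ⟩
      U ^ n * (3 ^ co v * E) ≡⟨ *-assoc (U ^ n) (3 ^ co v) E ⟨
      U ^ n * 3 ^ co v * E ∎)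

  -- There is no empty product among expressions, and `one` has value 1. With its value 0, `three`
  -- serves as the unit: it is the initial accumulator in `reduced` and the initial cofactor in
  -- `cover`, whence the factor 3 there.
  val-⊗-three : ∀ e → val (e ⊗ three) ≃ val e
  val-⊗-three e = ≃-trans (coord-≡ {{eval-nonZero (e ⊗ three)}} {{eval-nonZero (three ⊗ e)}} (+-comm (size e) 3) (*-comm (eval e) 3))
    (shift3 (size e) (eval e) {{eval-nonZero e}})

  reduced : ∀ e → val e ≼ v → holds P (size e) → Bounded e → ∃[ e' ] size e' ≤ B × holds P (size e') × val e ≃ val e'
  reduced e q h b = conclude (reduce b three)
    where
    conclude : (∃[ n ] ∃[ e' ] val e' ≃ val (e ⊗ three) × size e' ≤ 3 + n * G × (suc U) ^ n * eval e ^ 3 ≤ U ^ n * 3 ^ size e) →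
               ∃[ e' ] size e' ≤ B × holds P (size e') × val e ≃ val e'
    conclude (n , e' , s , t , u) = e' , ≤-trans t (B-bound (leaf-count n e q u)) ,
        holds-≃ P {val e} {val e'} e≃e' h , e≃e'
      where
      e≃e' : val e ≃ val e'
      e≃e' = ≃-trans (≃-sym (val-⊗-three e)) (≃-sym s)

  cover : ∀ e → up w ≺ val e → val e ≼ v → holds P (size e) →
          (∃[ e' ] size e' ≤ B × holds P (size e') × val e ≃ val e') ⊎ Exceptional (eval e * 3)
  cover e p q h = [ (λ b → inj₁ (reduced e q h b)) , inj₂ ]′
    (bounded-or-exceptional {eval e * 3} {size e + 3} {{eval-nonZero (e ⊗ three)}} (≺-≼-trans p (≃⇒≽ (val-⊗-three e))) (≼-trans (≃⇒≼ (val-⊗-three e)) q)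
       (+3*⁺ P 1 h) e three refl refl)

-- Approximation from below.

-- The number is multiplied by 3^k at the usual cost and then enlarged by `b` free of charge. For
-- fixed b > 0 the value stays below that of `u` and tends to it as `k` grows.
near : ℕ → V → ℕ → V
near k u b = ⟨ 3 * k + co u , 3 ^ k * arg u + b ⟩
  {{>-nonZero (≤-trans (>-nonZero⁻¹ (3 ^ k * arg u) {{m*n≢0 (3 ^ k) (arg u) {{3^≢0 k}}}}) (m≤m+n _ b))}}

near-≺ : ∀ k u b → 0 < b → near k u b ≺ u
near-≺ k u b b>0 = ≺-≼-trans (≺-arg {{_}} {{m*n≢0 (3 ^ k) (arg u) {{3^≢0 k}}}} refl (m<m+n _ b>0)) (≃⇒≼ (shift3^ k (co u) (arg u)))

near-bound : ∀ {r u} b → r ≺ u → ∃[ k₀ ] (∀ k → k₀ ≤ k → ∀ b' → b' ≤ b → r ≺ near k u b')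
-- Since 3^k > k, the first term makes the increase of the cube smaller than the integer gap in
-- `r ≺ u`; the second gives b' ≤ 3^k m, which `cube-+-≤` requires.
near-bound {r} {u} b (≺⁺ p) = 7 * X * (m * m) * b + b , λ k k₀≤k b' b'≤b → ≺⁺ (lim k k₀≤k b' b'≤b)
  where
  X = 3 ^ co r
  m = arg u
  lim : ∀ k → 7 * X * (m * m) * b + b ≤ k → ∀ b' → b' ≤ b → X * (3 ^ k * m + b') ^ 3 < 3 ^ (3 * k + co u) * arg r ^ 3
  lim k k₀≤k b' b'≤b = begin-strict
    X * (T * m + b') ^ 3 ≤⟨ *-monoʳ-≤ X (cube-+-≤ {T * m} {b'} b'≤Tm) ⟩
    X * ((T * m) ^ 3 + 7 * (T * m * (T * m) * b')) ≡⟨ trans (cong (λ x → X * (x + 7 * (T * m * (T * m) * b'))) (cube-* T m)) (lem X T (T ^ 3) m (m ^ 3) b') ⟩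
    X * m ^ 3 * T ^ 3 + T * T * (7 * X * (m * m) * b') <⟨ +-monoʳ-< (X * m ^ 3 * T ^ 3) (*-monoʳ-< (T * T) {{m*n≢0 T T}} small) ⟩
    X * m ^ 3 * T ^ 3 + T * T * T ≡⟨ lem₂ (X * m ^ 3) T ⟩
    suc (X * m ^ 3) * T ^ 3 ≤⟨ *-monoˡ-≤ (T ^ 3) p ⟩
    3 ^ co u * arg r ^ 3 * T ^ 3 ≡⟨ *-swap23 (3 ^ co u) (arg r ^ 3) (T ^ 3) ⟩
    3 ^ co u * T ^ 3 * arg r ^ 3 ≡⟨ cong (_* arg r ^ 3) (trans (*-comm (3 ^ co u) (T ^ 3))
        (trans (cong (_* 3 ^ co u) (trans (^-*-assoc 3 k 3) (cong (3 ^_) (*-comm k 3)))) (sym (^-distribˡ-+-* 3 (3 * k) (co u))))) ⟩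
    3 ^ (3 * k + co u) * arg r ^ 3 ∎
    where
    open ≤-Reasoning
    T = 3 ^ k
    instance
      T≢0 : NonZero T
      T≢0 = 3^≢0 k
    b'≤Tm : b' ≤ T * m
    b'≤Tm = ≤-trans b'≤b (≤-trans (m≤n+m b _) (≤-trans k₀≤k (≤-trans (<⇒≤ (n<3^n k)) (m≤m*n T m))))
    small : 7 * X * (m * m) * b' < T
    small = ≤-<-trans (*-monoʳ-≤ (7 * X * (m * m)) b'≤b) (≤-<-trans (m≤m+n _ b) (≤-<-trans k₀≤k (n<3^n k)))
    lem : ∀ X T T³ m m³ b → X * (T³ * m³ + 7 * (T * m * (T * m) * b)) ≡ X * m³ * T³ + T * T * (7 * X * (m * m) * b)
    lem = solve-∀
    lem₂ : ∀ a T → a * (T * (T * (T * 1))) + T * T * T ≡ suc a * (T * (T * (T * 1)))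
    lem₂ = solve-∀

opaque
  near-limit : ∀ {r u} b → r ≺ u → ∃[ k₀ ] (∀ k → k₀ ≤ k → ∀ b' → b' ≤ b → r ≺ near k u b')
  near-limit = near-bound

-- The expression 3^k e + 1 costs 1 more than 3^k e, while the change of the number becomes
-- negligible; so the values tend to that of `e` plus 1, from below.
approach-near : ∀ {P r y} → C (prev P) y → r ≺ up y → ∃[ z ] C P z × r ≺ z × z ≺ up y
approach-near {P} {r} {y} (mkC e j h q) p = near k u 1 , mkC (pow3 k e ⊕ one) j class near≃ ,
      proj₂ lim k ≤-refl 1 ≤-refl , ≺-≼-trans (near-≺ k u 1 (s≤s z≤n)) (≃⇒≽ (up-cong q))
  where
  u = up (val₊ e j)
  lim : ∃[ k₀ ] (∀ k → k₀ ≤ k → ∀ b' → b' ≤ 1 → r ≺ near k u b')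
  lim = near-limit {r} {u} 1 (≺-≼-trans p (≃⇒≼ (up-cong q)))
  k = proj₁ lim
  lem₁ : ∀ k s j → suc (s + j) + 3 * k ≡ 3 * k + s + 1 + j
  lem₁ = solve-∀
  lem₂ : ∀ k s j → 3 * k + suc (s + j) ≡ 3 * k + s + 1 + j
  lem₂ = solve-∀
  class : holds P (size (pow3 k e ⊕ one) + j)
  class = subst (holds P) (trans (lem₁ k (size e) j) (cong (λ x → x + 1 + j) (sym (size-pow3 k e)))) (+3*⁺ P k h)
  near≃ : near k u 1 ≃ val₊ (pow3 k e ⊕ one) j
  near≃ = coord-≡ {{_}} {{eval-nonZero (pow3 k e ⊕ one)}} (trans (lem₂ k (size e) j) (cong (λ x → x + 1 + j) (sym (size-pow3 k e))))
        (cong (_+ 1) (sym (eval-pow3 k e)))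

opaque
  approach : ∀ {P r y} → C (prev P) y → r ≺ up y → ∃[ z ] C P z × r ≺ z × z ≺ up y
  approach = approach-near

-- Search in finite lists of values.

maxSat : ∀ {B Q : V → Set} (B? : ∀ x → Dec (B x)) b {ℓ} → All Q ℓ →
         ∃[ w ] (w ≡ b ⊎ (Q w × B w)) × b ≼ w × All (λ x → B x → x ≼ w) ℓ
maxSat B? b [] = b , inj₁ refl , ≼-refl , []
maxSat B? b {x ∷ ℓ} (q ∷ qs) with maxSat B? b qs | B? x
... | w , i , b≼w , all≼w | no ¬Bx = w , i , b≼w , (λ Bx → ⊥-elim (¬Bx Bx)) ∷ all≼w
... | w , i , b≼w , all≼w | yes Bx with ≺-or-≽ w x
... | inj₂ x≼w = w , i , b≼w , (λ _ → x≼w) ∷ all≼w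
... | inj₁ w≺x = x , inj₂ (q , Bx) , ≼-trans b≼w (≺⇒≼ w≺x) , (λ _ → ≼-refl) ∷ All.map (λ f Bx → ≼-trans (f Bx) (≺⇒≼ w≺x)) all≼w

minAbove : ∀ {v} b → v ≺ b → ∀ ℓ → ∃[ σ ] v ≺ σ × σ ≼ b × All (λ x → v ≺ x → σ ≼ x) ℓ
minAbove b v≺b [] = b , v≺b , ≼-refl , []
minAbove {v} b v≺b (x ∷ ℓ) with minAbove b v≺b ℓ | v ≺? x
... | σ , p , q , r | no ¬v≺x = σ , p , q , (λ v≺x → ⊥-elim (¬v≺x v≺x)) ∷ r
... | σ , p , q , r | yes v≺x with ≺-or-≽ σ x
... | inj₁ σ≺x = σ , p , q , (λ _ → ≺⇒≼ σ≺x) ∷ r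
... | inj₂ x≼σ = x , v≺x , ≼-trans x≼σ q , (λ _ → ≼-refl) ∷ All.map (λ f v≺y → ≼-trans x≼σ (f v≺y)) r

All-Any : ∀ {A : Set} {P Q : A → Set} {ℓ} → All P ℓ → Any Q ℓ → ∃[ x ] P x × Q x
All-Any (p ∷ _) (here q) = _ , p , q
All-Any (_ ∷ ps) (there q) = All-Any ps q

count : V → List V → ℕ
count z [] = 0
count z (x ∷ ℓ) with x ≺? z
... | yes _ = suc (count z ℓ)
... | no _ = count z ℓ

count-mono-≤ : ∀ {z' z} ℓ → z' ≺ z → count z' ℓ ≤ count z ℓ
count-mono-≤ [] p = z≤n
count-mono-≤ {z'} {z} (x ∷ ℓ) p with x ≺? z' | x ≺? z
... | yes _ | yes _ = s≤s (count-mono-≤ ℓ p)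
... | yes q | no r = ⊥-elim (r (≺-trans q p))
... | no _ | yes _ = m≤n⇒m≤1+n (count-mono-≤ ℓ p)
... | no _ | no _ = count-mono-≤ ℓ p

count-mono-< : ∀ {z' z ℓ} → z' ≺ z → Any (z' ≃_) ℓ → count z' ℓ < count z ℓ
count-mono-< {z'} {z} {x ∷ ℓ} p (here z'≃x) with x ≺? z' | x ≺? z
... | yes q | _ = ⊥-elim (≺⇒≄ q (≃-sym z'≃x))
... | no _ | yes _ = s≤s (count-mono-≤ ℓ p)
... | no _ | no r = ⊥-elim (r (≼-≺-trans (≃⇒≽ z'≃x) p))
count-mono-< {z'} {z} {x ∷ ℓ} p (there z'∈ℓ) with x ≺? z' | x ≺? z
... | yes _ | yes _ = s≤s (count-mono-< p z'∈ℓ)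
... | yes q | no r = ⊥-elim (r (≺-trans q p))
... | no _ | yes _ = m≤n⇒m≤1+n (count-mono-< p z'∈ℓ)
... | no _ | no _ = count-mono-< p z'∈ℓ

-- Stands for -∞: it lies more than 1 below every value.
low : V
low = ⟨ 2 , 6 ⟩

up-low≺𝟎 : up low ≺ 𝟎
up-low≺𝟎 = ≺⁺ (from-yes (27 <? 216))

up-low≺C : ∀ {P z} → C P z → up low ≺ z
up-low≺C c = ≺-≼-trans up-low≺𝟎 (C-nonneg c)

low≺C : ∀ {P z} → C P z → low ≺ z
low≺C c = ≺-trans ≺-up (up-low≺C c)

-- Determination of `C` by induction on the cost.

-- Here `w` is the largest point of `C P` up to `v`, or `low` if there is none. That `σ` lies
-- strictly above `v` says that there is no limit from above at `v`.
record Floor (P : Class) (v : V) : Set where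
  field
    w σ : V
    v≺σ : v ≺ σ
    base : (C P w × w ≼ v) ⊎ w ≡ low
    gap : ∀ z → C P z → w ≺ z → z ≺ σ → ⊥

-- Here `up w` is the last limit point up to `v`. Beyond it, and until `σ` past `v`, only the
-- finitely many listed points occur.
record Local (P : Class) (v : V) : Set where
  field
    w σ : V
    v≺σ : v ≺ σ
    base : (C (prev P) w × up w ≼ v) ⊎ w ≡ low
    gap : ∀ z → C (prev P) z → w ≺ z → up z ≺ σ → ⊥
    list : List V
    listed : All (C P) list
    covers : ∀ z → C P z → up w ≺ z → z ≺ σ → Any (z ≃_) list

opaque
  exprList : Class → ℕ → List V
  exprList P B = map val (filter (holds? P ∘ size) (exprsUpTo B))

  exprList-C : ∀ P B → All (C P) (exprList P B)
  exprList-C P B = All.map⁺ (All.tabulate λ {e} e∈ → C-val e (proj₂ (∈-filter⁻ (holds? P ∘ size) {xs = exprsUpTo B} e∈)))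

  exprList-∋ : ∀ {P B z} e → size e ≤ B → holds P (size e) → z ≃ val e → Any (z ≃_) (exprList P B)
  exprList-∋ {P} {B} e s h q = lose (∈-map⁺ val (∈-filter⁺ (holds? P ∘ size) (exprsUpTo-complete B e s) h)) q

-- On a gap of `C (prev P)` the exceptional case of `Cover` is void, so shifted by 1 the gap
-- contains only values of expressions of bounded size. `v'` is tied to `up v` by value only, since
-- one value has many pairs.
module Step {P v v'} (v'≃ : v' ≃ up v) (F : Floor (prev P) v) where
  open Floor F

  v'≺σ+1 : v' ≺ up σ
  v'≺σ+1 = ≼-≺-trans (≃⇒≼ v'≃) (up-mono-≺ v≺σ)

  lim : ∃[ k₀ ] (∀ k → k₀ ≤ k → ∀ b' → b' ≤ 1 → v' ≺ near k (up σ) b')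
  lim = near-limit {v'} {up σ} 1 v'≺σ+1

  -- `Cover` needs an upper end strictly below `σ + 1`, and `Local` needs one strictly above `v'`;
  -- `near` supplies a pair in between.
  σ' : V
  σ' = near (proj₁ lim) (up σ) 1

  v'≺σ' : v' ≺ σ'
  v'≺σ' = proj₂ lim (proj₁ lim) ≤-refl 1 ≤-refl

  σ'≺σ+1 : σ' ≺ up σ
  σ'≺σ+1 = near-≺ (proj₁ lim) (up σ) 1 (s≤s z≤n)

  open Cover P w σ σ' σ'≺σ+1 (λ _ → ⊥) gap

  covered : ∀ {z} e → z ≃ val e → (∃[ e' ] size e' ≤ B × holds P (size e') × val e ≃ val e') ⊎ Exceptional (eval e * 3) →
            Any (z ≃_) (exprList P B)
  covered e z≃e (inj₁ (e' , s , h' , e≃e')) = exprList-∋ {P} {B} e' s h' (≃-trans z≃e e≃e')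
  covered e z≃e (inj₂ x) = ⊥-elim (Exceptional.value x)

  covers : ∀ z → C P z → up w ≺ z → z ≺ σ' → Any (z ≃_) (exprList P B)
  covers z c p q = [ (λ (e , h , z≃e) → covered e z≃e (cover e (w≺ e z≃e) (≼σ' e z≃e) h)) , (λ d → ⊥-elim (gap (dn z) d w≺z-1 z-1≺σ)) ]′ (C-val⁻ c)
    where
    w≺ : ∀ e → z ≃ val e → up w ≺ val e
    w≺ e z≃e = ≺-≼-trans p (≃⇒≼ z≃e)
    ≼σ' : ∀ e → z ≃ val e → val e ≼ σ'
    ≼σ' e z≃e = ≼-trans (≃⇒≽ z≃e) (≺⇒≼ q)
    w≺z-1 : w ≺ dn z
    w≺z-1 = up-≺⇒≺-dn p
    z-1≺σ : dn z ≺ σ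
    z-1≺σ = ≺-up⇒dn-≺ (≺-trans q σ'≺σ+1)

  floor⇒local : Local P v'
  floor⇒local = record
    { w = w ; σ = σ' ; v≺σ = v'≺σ'
    ; base = [ (λ b → inj₁ (proj₁ b , ≼-trans (up-mono-≼ (proj₂ b)) (≃⇒≽ v'≃))) , inj₂ ]′ base
    ; gap = λ z c p q → gap z c p (up-cancel-≺ (≺-trans q σ'≺σ+1))
    ; list = exprList P B ; listed = exprList-C P B ; covers = covers }

open Step using (floor⇒local)

-- The finite list is searched for its largest entry up to `v` and its smallest entry beyond `v`;
-- where none qualifies, `up w` and `σ` take their places.
local⇒floor : ∀ {P v} → Local P v → Floor P v
local⇒floor {P} {v} L with minAbove (Local.σ L) (Local.v≺σ L) (Local.list L) | maxSat (_≼? v) (up (Local.w L)) (Local.listed L)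
... | σ' , v≺σ' , σ'≼σ , above | m , m∈ , w+1≼m , below = result m∈
  where
  open Local L
  gap' : ∀ z → C P z → up w ≺ z → m ≺ z → z ≺ σ' → ⊥
  gap' z c p q r = contradict (All-Any above (covers z c p (≺-≼-trans r σ'≼σ))) (All-Any below (covers z c p (≺-≼-trans r σ'≼σ))) (≺-or-≽ v z)
    where
    contradict : (∃[ x ] (v ≺ x → σ' ≼ x) × z ≃ x) → (∃[ y ] (y ≼ v → y ≼ m) × z ≃ y) → v ≺ z ⊎ z ≼ v → ⊥
    contradict (x , f , z≃x) _ (inj₁ v≺z) = ≺⇒⋡ r (≼-trans (f (≺-≼-trans v≺z (≃⇒≼ z≃x))) (≃⇒≽ z≃x))
    contradict _ (y , g , z≃y) (inj₂ z≼v) = ≺⇒⋡ q (≼-trans (≃⇒≼ z≃y) (g (≼-trans (≃⇒≽ z≃y) z≼v)))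
  result : m ≡ up w ⊎ (C P m × m ≼ v) → Floor P v
  result (inj₂ i) = record { w = m ; σ = σ' ; v≺σ = v≺σ' ; base = inj₁ i ; gap = λ z c q → gap' z c (≼-≺-trans w+1≼m q) q }
  result (inj₁ refl) with base
  ... | inj₁ (c , p) = record { w = up w ; σ = σ' ; v≺σ = v≺σ' ; base = inj₁ (C-up c , p) ; gap = λ z c q → gap' z c q q }
  -- Even `up low` lies below all points, so falling back to `low` adds none to the gap.
  ... | inj₂ refl = record { w = low ; σ = σ' ; v≺σ = v≺σ' ; base = inj₂ refl ; gap = λ z c q → gap' z c (up-low≺C c) (up-low≺C c) }

floor-negative : ∀ {P v} → v ≺ 𝟎 → Floor P v
floor-negative p = record { w = low ; σ = 𝟎 ; v≺σ = p ; base = inj₂ refl ; gap = λ z c _ q → ≺⇒⋡ q (C-nonneg c) }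

opaque
  -- Lowering the cost by 1 lowers the value by 1 and passes to the previous class. At cost 0 the
  -- value is negative unless the number is 1; then the value is 0 = -1 + 1, with -1 written as ⟨ 2
  -- , 3 ⟩.
  floor : ∀ P v → Floor P v
  floor P ⟨ suc c , m ⟩ = local⇒floor (floor⇒local {v = ⟨ c , m ⟩} ≃-refl (floor (prev P) ⟨ c , m ⟩))
  floor P ⟨ 0 , 1 ⟩ = local⇒floor (floor⇒local {v = ⟨ 2 , 3 ⟩} (≃⁺ refl) (floor-negative (≺⁺ (from-yes (9 <? 27)))))
  floor P ⟨ 0 , suc (suc m) ⟩ = floor-negative (≺⁺ (≤-trans (m<m+n 1 (s≤s z≤n)) (≤-trans (cube-mono {2} {2 + m} (s≤s (s≤s z≤n))) (≤-reflexive (sym (*-identityˡ _))))))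

  local : ∀ P v → Local P v
  local P v = floor⇒local {v = dn v} (≃-sym up-dn) (floor (prev P) (dn v))

opaque
  C? : ∀ P v → Dec (C P v)
  C? P v with floor P v
  ... | record { w = w ; v≺σ = v≺σ ; base = inj₂ refl ; gap = gap } = no λ c → gap v c (low≺C c) v≺σ
  ... | record { w = w ; v≺σ = v≺σ ; base = inj₁ (c , w≼v) ; gap = gap } with ≼⇒≺⊎≃ w≼v
  ... | inj₁ w≺v = no λ d → gap v d w≺v v≺σ
  ... | inj₂ w≃v = yes (C-resp w≃v c)

-- Well-foundedness

data AccC (P : Class) (z : V) : Set where
  acc : (∀ z' → C P z' → z' ≺ z → AccC P z') → AccC P z

AccC-≼ : ∀ {P z' z} → z' ≼ z → AccC P z → AccC P z'
AccC-≼ p (acc f) = acc λ y c q → f y c (≺-≼-trans q p)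

-- The number of list entries below `z` drops with each step down, until the accessible point `u` is
-- reached.
AccC-list : ∀ {P u} → AccC P u → ∀ ℓ n z → count z ℓ < n → (∀ z' → C P z' → u ≺ z' → z' ≺ z → Any (z' ≃_) ℓ) → AccC P z
AccC-list {P} {u} a ℓ (suc n) z p cov = acc below
  where
  below : ∀ z' → C P z' → z' ≺ z → AccC P z'
  below z' c q with ≺-or-≽ u z'
  ... | inj₂ z'≼u = AccC-≼ z'≼u a
  ... | inj₁ u≺z' = AccC-list a ℓ n z' (<-≤-trans (count-mono-< q (cov z' c u≺z' q)) (s≤s⁻¹ p))
                      (λ y d r s → cov y d r (≺-trans s q))

-- Below `z` there are finitely many points down to the last limit `w + 1`. As w + 1 ≤ z < v + 1,
-- the point `w` is below `v`, and the recursion is on the accessibility of `v` in the previous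
-- class.
AccC-up : ∀ {P v} → AccC (prev P) v → AccC P (up v)
AccC-up {P} {v} (acc f) = acc λ z c p → AccC-list (start z p) (list (local P z)) (suc (count z (list (local P z)))) z ≤-refl
    (λ z' d q r → covers (local P z) z' d q (≺-trans r (v≺σ (local P z))))
  where
  open Local
  start : ∀ z → z ≺ up v → AccC P (up (w (local P z)))
  start z p with w (local P z) | base (local P z)
  ... | w | inj₁ (c , q) = AccC-up (f w c (up-cancel-≺ (≼-≺-trans q p)))
  ... | _ | inj₂ refl = acc λ z' c q → ⊥-elim (≺⇒⋡ (up-low≺C c) (≺⇒≼ q))

opaque
  accC : ∀ P v → AccC P v
  accC P ⟨ suc c , m ⟩ = AccC-up (accC (prev P) ⟨ c , m ⟩)
  accC P ⟨ zero , m ⟩ = acc λ z d p → ⊥-elim (≺⇒⋡ p (≼-trans {v = 𝟎} (≼⁺ (*-monoʳ-≤ 1 (cube-mono {1} {m} (>-nonZero⁻¹ m)))) (C-nonneg d)))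

-- The values of D

E : Class → V → Set
E P z = C P z × ¬ C (prev P) (dn z)

E-resp : ∀ {P z z'} → z ≃ z' → E P z → E P z'
E-resp p (c , n) = C-resp p c , λ d → n (C-resp (dn-cong (≃-sym p)) d)

record LeftGap (P : Class) (q : V) : Set where
  field
    r : V
    r≺q : r ≺ q
    base : C P r ⊎ r ≡ low
    gap : ∀ z → C P z → r ≺ z → z ≺ q → ⊥

opaque
  -- The limits are the points of `C (prev P)` plus 1, and `q` is none of them. So the last limit up
  -- to `q` is strictly below `q`, with finitely many points in between.
  leftGap : ∀ {P q} → E P q → LeftGap P q
  leftGap {P} {q} (q∈C , q-1∉C) with maxSat (_≺? q) (up (Local.w (local P q))) (Local.listed (local P q))
  ... | m , m∈ , w+1≼m , below = result m∈
    where
    open Local (local P q)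
    gap' : ∀ z → C P z → up w ≺ z → m ≺ z → z ≺ q → ⊥
    gap' z c p m≺z z≺q = contradict (All-Any below (covers z c p (≺-trans z≺q v≺σ)))
      where
      contradict : (∃[ x ] (x ≺ q → x ≼ m) × z ≃ x) → ⊥
      contradict (x , f , z≃x) = ≺⇒⋡ m≺z (≼-trans (≃⇒≼ z≃x) (f (≼-≺-trans (≃⇒≽ z≃x) z≺q)))
    result : m ≡ up w ⊎ (C P m × m ≺ q) → LeftGap P q
    result (inj₂ (c , p)) = record { r = m ; r≺q = p ; base = inj₁ c ; gap = λ z c p → gap' z c (≼-≺-trans w+1≼m p) p }
    result (inj₁ refl) with base
    ... | inj₂ w≡low = record { r = low ; r≺q = low≺C q∈C ; base = inj₂ refl ; gap = λ z c _ → gap' z c (w+1≺ c) (w+1≺ c) }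
      where
      w+1≺ : ∀ {z} → C P z → up w ≺ z
      w+1≺ {z} c = subst (λ x → up x ≺ z) (sym w≡low) (up-low≺C c)
    ... | inj₁ (c , p) with ≼⇒≺⊎≃ p
    ... | inj₁ w+1≺q = record { r = up w ; r≺q = w+1≺q ; base = inj₁ (C-up c) ; gap = λ z c p → gap' z c p p }
    ... | inj₂ w+1≃q = ⊥-elim (q-1∉C (C-resp (≃-trans (≃-sym dn-up) (dn-cong w+1≃q)) c))

opaque
  -- A point of `C` outside `E` is a limit from below, so a smaller point of `C` above `r` can
  -- replace it; well-foundedness ends this.
  density : ∀ {P c r} → AccC P c → C P c → r ≺ c → ∃[ e ] E P e × r ≺ e × e ≼ c
  density {P} {c} (acc f) c∈C r≺c with C? (prev P) (dn c)
  ... | no ¬d = c , (c∈C , ¬d) , r≺c , ≼-refl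
  ... | yes d with approach d (≺-≼-trans r≺c (≃⇒≽ up-dn))
  ... | z , z∈C , r≺z , z≺c with density (f z z∈C (≺-≼-trans z≺c (≃⇒≼ up-dn))) z∈C r≺z
  ... | e , e∈E , r≺e , e≼z = e , e∈E , r≺e , ≼-trans e≼z (≺⇒≼ (≺-≼-trans z≺c (≃⇒≼ up-dn)))

  dense : ∀ {P c r} → C P c → r ≺ c → ∃[ e ] E P e × r ≺ e × e ≼ c
  dense {P} {c} = density (accC P c)

Least : Class → V → V → V → Set
Least P r z e = E P e × r ≺ e × e ≼ z × (∀ e' → E P e' → r ≺ e' → e ≼ e')

opaque
  -- Let g be the point of `C` just before `z`. If g > r, then `dense` gives an element of `E` above
  -- `r` and up to g, from which the search goes on; otherwise nothing lies between `r` and `z`.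
  least-acc : ∀ {P r z} → AccC P z → E P z → r ≺ z → ∃[ e ] Least P r z e
  least-acc {P} {r} {z} (acc f) z∈E r≺z with leftGap z∈E
  ... | record { base = inj₂ refl ; gap = gap } = z , z∈E , r≺z , ≼-refl , minimal
    where
    minimal : ∀ e' → E P e' → r ≺ e' → z ≼ e'
    minimal e' i p with ≺-or-≽ e' z
    ... | inj₂ q = q
    ... | inj₁ q = ⊥-elim (gap e' (proj₁ i) (low≺C (proj₁ i)) q)
  ... | record { r = g ; r≺q = g≺z ; base = inj₁ g∈C ; gap = gap } with ≺-or-≽ r g
  ... | inj₁ r≺g with dense g∈C r≺g
  ... | e , e∈E , r≺e , e≼g with least-acc (f e (proj₁ e∈E) (≼-≺-trans e≼g g≺z)) e∈E r≺e
  ... | e' , i , p , q , m = e' , i , p , ≼-trans q (≼-trans e≼g (≺⇒≼ g≺z)) , m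
  least-acc {P} {r} {z} (acc f) z∈E r≺z | record { r = g ; r≺q = g≺z ; base = inj₁ g∈C ; gap = gap } | inj₂ g≼r = z , z∈E , r≺z , ≼-refl , minimal
    where
    minimal : ∀ e' → E P e' → r ≺ e' → z ≼ e'
    minimal e' i p with ≺-or-≽ e' z
    ... | inj₂ q = q
    ... | inj₁ q = ⊥-elim (gap e' (proj₁ i) (≼-≺-trans g≼r p) q)

  least : ∀ {P r z} → E P z → r ≺ z → ∃[ e ] Least P r z e
  least {P} {r} {z} = least-acc (accC P z)

-- Stable numbers

stable-nonZero : ∀ {m} → Stable m → NonZero m
stable-nonZero {zero} st = ⊥-elim (0≢1+n (st 1))
stable-nonZero {suc m} st = _

stable-3^ : ∀ k {m} → Stable m → Stable (3 ^ k * m)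
stable-3^ k {m} st i = begin
  cpx (3 ^ i * (3 ^ k * m)) ≡⟨ cong cpx (trans (sym (*-assoc (3 ^ i) (3 ^ k) m)) (cong (_* m) (sym (^-distribˡ-+-* 3 i k)))) ⟩
  cpx (3 ^ (i + k) * m) ≡⟨ st (i + k) ⟩
  3 * (i + k) + cpx m ≡⟨ lem i k (cpx m) ⟩
  3 * i + (3 * k + cpx m) ≡⟨ cong (3 * i +_) (st k) ⟨
  3 * i + cpx (3 ^ k * m) ∎
  where
  open ≡-Reasoning
  lem : ∀ i k c → 3 * (i + k) + c ≡ 3 * i + (3 * k + c)
  lem = solve-∀

*-swap-3^ : ∀ a b y → 3 ^ a * (3 ^ b * y) ≡ 3 ^ b * (3 ^ a * y)
*-swap-3^ a b y = lem (3 ^ a) (3 ^ b) y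
  where
  lem : ∀ x z y → x * (z * y) ≡ z * (x * y)
  lem = solve-∀

stable-unique : ∀ a b {y} → Stable (3 ^ a * y) → Stable (3 ^ b * y) → 3 * b + cpx (3 ^ a * y) ≡ 3 * a + cpx (3 ^ b * y)
stable-unique a b {y} st st' = trans (sym (st b)) (trans (cong cpx (*-swap-3^ b a y)) (st' a))

stable-mono : ∀ {a b y} → a ≤ b → Stable (3 ^ a * y) → Stable (3 ^ b * y)
stable-mono {a} {b} {y} a≤b st = subst Stable (trans (sym (*-assoc (3 ^ (b ∸ a)) (3 ^ a) y))
  (cong (_* y) (trans (sym (^-distribˡ-+-* 3 (b ∸ a) a)) (cong (3 ^_) (m∸n+n≡m a≤b))))) (stable-3^ (b ∸ a) st)

δV : ∀ m .{{_ : NonZero m}} → V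
δV m = ⟨ cpx m , m ⟩

stable-unique-≃ : ∀ a b y .{{_ : NonZero (3 ^ a * y)}} .{{_ : NonZero (3 ^ b * y)}} →
                  Stable (3 ^ a * y) → Stable (3 ^ b * y) → δV (3 ^ a * y) ≃ δV (3 ^ b * y)
stable-unique-≃ a b y st st' = ≃-trans (≃-sym (shift3^ b (cpx (3 ^ a * y)) (3 ^ a * y)))
  (≃-trans (coord-≡ {{m*n≢0 (3 ^ b) (3 ^ a * y) {{3^≢0 b}}}} {{m*n≢0 (3 ^ a) (3 ^ b * y) {{3^≢0 a}}}} (stable-unique a b st st') (*-swap-3^ b a y))
    (shift3^ a (cpx (3 ^ b * y)) (3 ^ b * y)))

-- Any saving beyond 1 can be filled up with slack, so a shorter `f`, of whatever class, would put z
-- - 1 into `C (prev P)`.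
E-shortest : ∀ {P z} f s .{{_ : NonZero (eval f)}} → E P z → z ≃ ⟨ s , eval f ⟩ → holds P s → s ≤ size f
E-shortest {P} {z} f s (_ , z-1∉C) z≃ h = ≮⇒≥ λ f<s → z-1∉C (mkC f (s ∸ suc (size f)) (subst (holds P) (sym (m+[n∸m]≡n f<s)) h)
  (≃-trans (dn-cong (≃-trans z≃ (coord-≡ {{_}} {{eval-nonZero f}} (sym (m+[n∸m]≡n f<s)) refl))) dn-up))

E-val⇒stable : ∀ {P} e → E P (val e) → holds P (size e) → size e ≡ cpx (eval e) × Stable (eval e)
E-val⇒stable {P} e e∈E h = sym cpx≡ , λ k → trans (cpx-3^ k) (cong (3 * k +_) (sym cpx≡))
  where
  instance
    e≢0 : NonZero (eval e)
    e≢0 = eval-nonZero e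
  cpx-3^ : ∀ k → cpx (3 ^ k * eval e) ≡ 3 * k + size e
  cpx-3^ k = ≤-antisym (≤-trans (cpx-3^* k (eval e)) (+-monoʳ-≤ (3 * k) (cpx-≤ e refl))) (lower (shortest (3 ^ k * eval e) {{3^e≢0}}))
    where
    3^e≢0 : NonZero (3 ^ k * eval e)
    3^e≢0 = m*n≢0 (3 ^ k) (eval e) {{3^≢0 k}}
    lower : (∃[ f ] eval f ≡ 3 ^ k * eval e × size f ≡ cpx (3 ^ k * eval e)) → 3 * k + size e ≤ cpx (3 ^ k * eval e)
    lower (f , p , q) = ≤-trans (E-shortest f (3 * k + size e) {{eval-nonZero f}} e∈E
        (≃-trans (≃-sym (shift3^ k (size e) (eval e))) (coord-≡ {{3^e≢0}} {{eval-nonZero f}} refl (sym p)))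
        (subst (holds P) (+-comm (size e) (3 * k)) (+3*⁺ P k h))) (≤-reflexive q)
  cpx≡ : cpx (eval e) ≡ size e
  cpx≡ = trans (cong cpx (sym (*-identityˡ (eval e)))) (cpx-3^ 0)

E⇒stable : ∀ {P z} → E P z → ∃[ m ] Σ (Stable m) λ st → z ≃ δV m {{stable-nonZero st}} × holds P (cpx m)
E⇒stable {P} {z} z∈E@(z∈C , z-1∉C) = [ found , (λ d → ⊥-elim (z-1∉C d)) ]′ (C-val⁻ z∈C)
  where
  found : (∃[ e ] holds P (size e) × z ≃ val e) → ∃[ m ] Σ (Stable m) λ st → z ≃ δV m {{stable-nonZero st}} × holds P (cpx m)
  found (e , h , z≃e) = eval e , st , ≃-trans z≃e (coord-≡ {{eval-nonZero e}} {{stable-nonZero st}} s≡ refl) , subst (holds P) s≡ h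
    where
    s≡×st = E-val⇒stable e (E-resp z≃e z∈E) h
    s≡ = proj₁ s≡×st
    st = proj₂ s≡×st

-- If z - 1 were in the closure, then by `≃⇒3^` its expression, multiplied by a power of 3, would
-- represent some 3^s m more cheaply than stability permits.
stable⇒E : ∀ {P m} (st : Stable m) → holds P (cpx m) → E P (δV m {{stable-nonZero st}})
stable⇒E {P} {m} st h = isC (shortest m) , not-C
  where
  instance
    m≢0 : NonZero m
    m≢0 = stable-nonZero st
  isC : (∃[ e ] eval e ≡ m × size e ≡ cpx m) → C P (δV m)
  isC (e , p , q) = C-resp (coord-≡ {{eval-nonZero e}} {{m≢0}} q p) (C-val e (subst (holds P) (sym q) h))
  not-C : ¬ C (prev P) (dn (δV m))
  not-C (mkC e j _ q) = contradict (≃⇒3^ (≃-trans (≃-sym up-dn) (up-cong q)))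
    where
    contradict : (∃[ s ] ∃[ t ] 3 ^ s * m ≡ 3 ^ t * eval e × cpx m + 3 * s ≡ suc (size e + j) + 3 * t) → ⊥
    contradict (s , t , p , c) = <⇒≱ (begin-strict
      3 * t + size e <⟨ s≤s (≤-trans (≤-reflexive (+-comm (3 * t) (size e))) (+-monoˡ-≤ (3 * t) (m≤m+n (size e) j))) ⟩
      suc (size e + j) + 3 * t ≡⟨ trans (sym c) (+-comm (cpx m) (3 * s)) ⟩
      3 * s + cpx m ∎)
      (begin
      3 * s + cpx m ≡⟨ st s ⟨
      cpx (3 ^ s * m) ≤⟨ cpx-≤ (pow3 t e) (trans (eval-pow3 t e) (sym p)) ⟩
      size (pow3 t e) ≡⟨ size-pow3 t e ⟩
      3 * t + size e ∎)
      where open ≤-Reasoning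

-- The cost is lowered while z - 1 remains in `C`. At cost 0 the value is at most 0, so
-- nonnegativity stops the descent. This yields a stable multiple 3^K y for every y.
C⇒E-all : ∀ c y .{{_ : NonZero y}} → C all ⟨ c , y ⟩ → ∃[ c' ] E all ⟨ c' , y ⟩
C⇒E-all c y i with C? all (dn ⟨ c , y ⟩)
... | no n = c , i , n
C⇒E-all zero y i | yes d = ⊥-elim (≺⇒⋡ (≺-≼-trans ≺-up (≼-trans (≃⇒≼ up-dn) y≼𝟎)) (C-nonneg d))
  where
  y≼𝟎 : ⟨ 0 , y ⟩ ≼ 𝟎
  y≼𝟎 = ≼⁺ (*-monoʳ-≤ 1 (cube-mono {1} {y} (>-nonZero⁻¹ y)))
C⇒E-all (suc c) y i | yes d = C⇒E-all c y (C-resp dn-up d)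

stable-exists : ∀ y .{{_ : NonZero y}} → ∃[ K ] Stable (3 ^ K * y)
stable-exists y = multiple (C⇒E-all (cpx y) y (isC (shortest y)))
  where
  isC : (∃[ e ] eval e ≡ y × size e ≡ cpx y) → C all (δV y)
  isC (e , p , q) = C-resp (coord-≡ {{eval-nonZero e}} q p) (C-val e tt)
  multiple : (∃[ c ] E all ⟨ c , y ⟩) → ∃[ K ] Stable (3 ^ K * y)
  multiple (c , i) = power (E⇒stable i)
    where
    power : (∃[ m ] Σ (Stable m) λ st → ⟨ c , y ⟩ ≃ δV m {{stable-nonZero st}} × holds all (cpx m)) → ∃[ K ] Stable (3 ^ K * y)
    power (m , st , q , _) with ≃⇒3^ q
    ... | s , t , p , _ = s , subst Stable (sym p) (stable-3^ t st)

3-part : ∀ n m .{{_ : NonZero m}} → m ≤ n → ∃[ α ] ∃[ a ] m ≡ 3 ^ α * a × ¬ (3 ∣ a)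
3-part zero (suc _) ()
3-part (suc n) m m≤n with 3 ∣? m
... | no 3∤m = 0 , m , sym (*-identityˡ m) , 3∤m
... | yes (divides q refl) with 3-part n q {{m*n≢0⇒m≢0 q}} (s≤s⁻¹ (<-≤-trans (m<m*n q 3 {{m*n≢0⇒m≢0 q}} (s≤s (s≤s z≤n))) m≤n))
... | α , a , p , 3∤a = suc α , a , trans (cong (_* 3) p) (trans (*-comm (3 ^ α * a) 3) (sym (*-assoc 3 (3 ^ α) a))) , 3∤a

3-part-unique : ∀ i j a b → ¬ (3 ∣ a) → ¬ (3 ∣ b) → 3 ^ i * a ≡ 3 ^ j * b → i ≡ j × a ≡ b
3-part-unique zero zero a b _ _ p = refl , trans (sym (*-identityˡ a)) (trans p (*-identityˡ b))
3-part-unique zero (suc j) a b 3∤a _ p = ⊥-elim (3∤a (subst (3 ∣_) (sym (trans (sym (*-identityˡ a)) (trans p (*-assoc 3 (3 ^ j) b)))) (m∣m*n (3 ^ j * b))))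
3-part-unique (suc i) zero a b _ 3∤b p = ⊥-elim (3∤b (subst (3 ∣_) (trans (sym (*-assoc 3 (3 ^ i) a)) (trans p (*-identityˡ b))) (m∣m*n (3 ^ i * a))))
3-part-unique (suc i) (suc j) a b 3∤a 3∤b p
  with 3-part-unique i j a b 3∤a 3∤b (*-cancelˡ-≡ _ _ 3 (trans (sym (*-assoc 3 (3 ^ i) a)) (trans p (*-assoc 3 (3 ^ j) b))))
... | q , r = cong suc q , r

3∤* : ∀ {a b} → ¬ (3 ∣ a) → ¬ (3 ∣ b) → ¬ (3 ∣ a * b)
3∤* {a} {b} 3∤a 3∤b d = [ 3∤a , 3∤b ]′ (euclidsLemma a b prime3 d)

-- Blocks of order type ω.

-- The block of ω elements of D approaching p + 1: those above e + 1 for all earlier e.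
record InQ (P : Class) (p q : V) : Set where
  constructor mkInQ
  field
    isE : E P q
    upper : q ≺ up p
    lower : ∀ e → E (prev P) e → e ≺ p → up e ≼ q

InQ-resp : ∀ {P p p' q} → p ≃ p' → InQ P p q → InQ P p' q
InQ-resp p≃p' (mkInQ i u l) = mkInQ i (≺-≼-trans u (≃⇒≼ (up-cong p≃p'))) (λ e e∈E e≺p' → l e e∈E (≺-≼-trans e≺p' (≃⇒≽ p≃p')))

E-near : ∀ {P p r} → E (prev P) p → r ≺ up p → ∃[ t ] E P t × r ≺ t × t ≺ up p
E-near (p∈C , _) r≺p+1 with approach p∈C r≺p+1
... | z , z∈C , r≺z , z≺p+1 with dense z∈C r≺z
... | t , t∈E , r≺t , t≼z = t , t∈E , r≺t , ≼-≺-trans t≼z z≺p+1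

-- With r the point of `C (prev P)` just before `p`, membership in the block, a condition on all
-- earlier `e`, becomes membership in the interval from r + 1 to p + 1.
module Block {P p} (p∈E : E (prev P) p) where

  open LeftGap (leftGap p∈E) public

  InQ-intro : ∀ {q} → E P q → q ≺ up p → up r ≺ q → InQ P p q
  InQ-intro {q} q∈E q≺p+1 r+1≺q = mkInQ q∈E q≺p+1 lower
    where
    lower : ∀ e → E (prev P) e → e ≺ p → up e ≼ q
    lower e e∈E e≺p with ≺-or-≽ r e
    ... | inj₁ r≺e = ⊥-elim (gap e (proj₁ e∈E) r≺e e≺p)
    ... | inj₂ e≼r = ≼-trans (up-mono-≼ e≼r) (≺⇒≼ r+1≺q)

  -- Suppose q ≤ r + 1 with r in `C (prev P)`. Equality contradicts that `q` is in `E`; otherwise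
  -- density gives an e in `E (prev P)` with q - 1 < e ≤ r < p, against `lower`.
  up-r≺ : ∀ {q} → InQ P p q → up r ≺ q
  up-r≺ {q} (mkInQ (q∈C , q-1∉C) q≺p+1 lower) = [ id , (λ q≼r+1 → ⊥-elim ([ inside q≼r+1 , outside q≼r+1 ]′ base)) ]′ (≺-or-≽ (up r) q)
    where
    outside : q ≼ up r → r ≡ low → ⊥
    outside q≼r+1 r≡low = ≺⇒⋡ (up-low≺C q∈C) (subst (λ x → q ≼ up x) r≡low q≼r+1)
    between : (∃[ e ] E (prev P) e × dn q ≺ e × e ≼ r) → ⊥
    between (e , e∈E , q-1≺e , e≼r) = ≺⇒⋡ q-1≺e (up-≼⇒≼-dn (lower e e∈E (≼-≺-trans e≼r r≺q)))
    inside : q ≼ up r → C (prev P) r → ⊥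
    inside q≼r+1 r∈C = [ (λ q-1≺r → between (dense r∈C q-1≺r)) , (λ q-1≃r → q-1∉C (C-resp (≃-sym q-1≃r) r∈C)) ]′ (≼⇒≺⊎≃ (≼-up⇒dn-≼ q≼r+1))

  Successor : V → V → Set
  Successor r₀ q = InQ P p q × r₀ ≺ q × (∀ q' → InQ P p q' → r₀ ≺ q' → q ≼ q')

  successor : ∀ {r₀} → up r ≼ r₀ → r₀ ≺ up p → ∃[ q ] Successor r₀ q
  successor {r₀} r+1≼r₀ r₀≺p+1 = below (E-near {P} p∈E r₀≺p+1)
    where
    found : ∀ {t} → t ≺ up p → ∃[ q ] Least P r₀ t q → ∃[ q ] Successor r₀ q
    found t≺p+1 (q , q∈E , r₀≺q , q≼t , minimal) =
      q , InQ-intro q∈E (≼-≺-trans q≼t t≺p+1) (≼-≺-trans r+1≼r₀ r₀≺q) , r₀≺q , λ q' i → minimal q' (InQ.isE i)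
    below : (∃[ t ] E P t × r₀ ≺ t × t ≺ up p) → ∃[ q ] Successor r₀ q
    below (t , t∈E , r₀≺t , t≺p+1) = found t≺p+1 (least t∈E r₀≺t)

data Rank (P : Class) (p : V) : ℕ → V → Set where
  first : ∀ {q} → InQ P p q → (∀ q' → InQ P p q' → q ≼ q') → Rank P p 0 q
  next : ∀ {j q₀ q} → Rank P p j q₀ → InQ P p q → q₀ ≺ q → (∀ q' → InQ P p q' → q₀ ≺ q' → q ≼ q') → Rank P p (suc j) q

Rank-InQ : ∀ {P p j q} → Rank P p j q → InQ P p q
Rank-InQ (first i _) = i
Rank-InQ (next _ i _ _) = i

Rank-resp : ∀ {P p p' j q} → p ≃ p' → Rank P p j q → Rank P p' j q
Rank-resp e (first i m) = first (InQ-resp e i) (λ q' i' → m q' (InQ-resp (≃-sym e) i'))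
Rank-resp e (next r i l m) = next (Rank-resp e r) (InQ-resp e i) l (λ q' i' → m q' (InQ-resp (≃-sym e) i'))

InQ-respʳ : ∀ {P p q q'} → q ≃ q' → InQ P p q → InQ P p q'
InQ-respʳ e (mkInQ i u l) = mkInQ (E-resp e i) (≼-≺-trans (≃⇒≽ e) u) (λ x x∈E x≺p → ≼-trans (l x x∈E x≺p) (≃⇒≼ e))

Rank-respʳ : ∀ {P p j q q'} → q ≃ q' → Rank P p j q → Rank P p j q'
Rank-respʳ e (first i m) = first (InQ-respʳ e i) (λ x i' → ≼-trans (≃⇒≽ e) (m x i'))
Rank-respʳ e (next r i l m) = next r (InQ-respʳ e i) (≺-≼-trans l (≃⇒≼ e)) (λ x i' l' → ≼-trans (≃⇒≽ e) (m x i' l'))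

Rank-mono-≤ : ∀ {P p p' j j' q q'} → p ≃ p' → Rank P p j q → Rank P p' j' q' → j ≤ j' → q ≼ q'
Rank-mono-≤ e (first _ m) r' _ = m _ (InQ-resp (≃-sym e) (Rank-InQ r'))
Rank-mono-≤ e (next r _ _ m) (next r' i' q₀'≺q' _) (s≤s p) =
  m _ (InQ-resp (≃-sym e) i') (≼-≺-trans (Rank-mono-≤ e r r' p) q₀'≺q')

Rank-mono-< : ∀ {P p p' j j' q q'} → p ≃ p' → Rank P p j q → Rank P p' j' q' → j < j' → q ≺ q'
Rank-mono-< e r (next r' _ q₀'≺q' _) (s≤s p) = ≼-≺-trans (Rank-mono-≤ e r r' p) q₀'≺q'

Rank-cancel-≺ : ∀ {P p p' j j' q q'} → p ≃ p' → Rank P p j q → Rank P p' j' q' → q ≺ q' → j < j'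
Rank-cancel-≺ e r r' q≺q' = ≰⇒> λ j'≤j → ≺⇒⋡ q≺q' (Rank-mono-≤ (≃-sym e) r' r j'≤j)

Rank-unique : ∀ {P p p' j j' q q'} → p ≃ p' → Rank P p j q → Rank P p' j' q' → q ≃ q' → j ≡ j'
Rank-unique {j = j} {j'} e r r' q≃q' with <-cmp j j'
... | tri≈ _ j≡j' _ = j≡j'
... | tri< j<j' _ _ = ⊥-elim (≺⇒≄ (Rank-mono-< e r r' j<j') q≃q')
... | tri> _ _ j'<j = ⊥-elim (≺⇒≄ (Rank-mono-< (≃-sym e) r' r j'<j) (≃-sym q≃q'))

nth : ∀ {P p} → E (prev P) p → ∀ j → ∃[ q ] Rank P p j q
nth {P} {p} p∈E zero = start (successor ≼-refl (up-mono-≺ r≺q))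
  where
  open Block {P} p∈E
  start : ∃[ q ] Successor (up r) q → ∃[ q ] Rank P p 0 q
  start (q , i , _ , m) = q , first i (λ q' i' → m q' i' (up-r≺ i'))
nth {P} {p} p∈E (suc j) = step (nth {P} p∈E j)
  where
  open Block {P} p∈E
  extend : ∀ {q₀} → Rank P p j q₀ → ∃[ q ] Successor q₀ q → ∃[ q ] Rank P p (suc j) q
  extend r₀ (q , i , q₀≺q , m) = q , next r₀ i q₀≺q m
  step : ∃[ q ] Rank P p j q → ∃[ q ] Rank P p (suc j) q
  step (q₀ , r₀) = extend r₀ (successor (≺⇒≼ (up-r≺ (Rank-InQ r₀))) (InQ.upper (Rank-InQ r₀)))

-- The point of `C P` just before `q` is again in the block if it lies above r + 1: otherwise,
-- lowered by 1, it would be a point of `C (prev P)` between r and p. So ranks are counted down by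
-- well-founded recursion.
rank-acc : ∀ {P p} → E (prev P) p → ∀ {q} → AccC P q → InQ P p q → ∃[ j ] Rank P p j q
rank-acc {P} {p} p∈E {q} (acc f) q∈Q = descend (LeftGap.base g)
  where
  open Block {P} p∈E
  g : LeftGap P q
  g = leftGap (InQ.isE q∈Q)
  module G = LeftGap g
  minimal : ∀ q' → InQ P p q' → G.r ≺ q' → q ≼ q'
  minimal q' i G≺q' with ≺-or-≽ q' q
  ... | inj₂ q≼q' = q≼q'
  ... | inj₁ q'≺q = ⊥-elim (G.gap q' (proj₁ (InQ.isE i)) G≺q' q'≺q)
  descend : C P G.r ⊎ G.r ≡ low → ∃[ j ] Rank P p j q
  descend (inj₂ e) = 0 , first q∈Q (λ q' i → minimal q' i (subst (_≺ q') (sym e) (low≺C (proj₁ (InQ.isE i)))))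
  descend (inj₁ c) = [ inside , (λ G≼r+1 → 0 , first q∈Q (λ q' i → minimal q' i (≼-≺-trans G≼r+1 (up-r≺ i)))) ]′ (≺-or-≽ (up r) G.r)
    where
    G≺p+1 : G.r ≺ up p
    G≺p+1 = ≺-trans G.r≺q (InQ.upper q∈Q)
    G∈Q : up r ≺ G.r → InQ P p G.r
    G∈Q r+1≺G = InQ-intro (c , λ d → gap (dn G.r) d (up-≺⇒≺-dn r+1≺G) (≺-up⇒dn-≺ G≺p+1)) G≺p+1 r+1≺G
    extend : (∃[ j ] Rank P p j G.r) → ∃[ j ] Rank P p j q
    extend (j , ρ) = suc j , next ρ q∈Q G.r≺q minimal
    inside : up r ≺ G.r → ∃[ j ] Rank P p j q
    inside r+1≺G = extend (rank-acc {P} p∈E (f G.r c G.r≺q) (G∈Q r+1≺G))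

rank : ∀ {P p} → E (prev P) p → ∀ {q} → InQ P p q → ∃[ j ] Rank P p j q
rank {P} p∈E {q} = rank-acc {P} p∈E (accC P q)

-- The block of `q` belongs to the least p of `E (prev P)` above q - 1; `N` witnesses that there is
-- one.
owner : ∀ {P N} → E (prev P) N → ∀ {q} → E P q → q ≺ up N → ∃[ p ] E (prev P) p × p ≼ N × InQ P p q
owner {P} {N} N∈E {q} q∈E q≺N+1 = result (least N∈E (≺-up⇒dn-≺ q≺N+1))
  where
  lower : ∀ {p} → (∀ e → E (prev P) e → dn q ≺ e → p ≼ e) → ∀ e → E (prev P) e → e ≺ p → up e ≼ q
  lower minimal e e∈E e≺p = [ (λ q≺e+1 → ⊥-elim (≺⇒⋡ e≺p (minimal e e∈E (≺-up⇒dn-≺ q≺e+1)))) , id ]′ (≺-or-≽ q (up e))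
  result : ∃[ p ] Least (prev P) (dn q) N p → ∃[ p ] E (prev P) p × p ≼ N × InQ P p q
  result (p , p∈E , q-1≺p , p≼N , minimal) = p , p∈E , p≼N , mkInQ q∈E (dn-≺⇒≺-up q-1≺p) (lower minimal)

owner-mono : ∀ {P p p' q q'} → InQ P p q → InQ P p' q' → E (prev P) p' → q ≼ q' → p ≼ p'
owner-mono {p = p} {p'} i i' p'∈E q≼q' with ≺-or-≽ p' p
... | inj₂ p≼p' = p≼p'
... | inj₁ p'≺p = ⊥-elim (≺⇒⋡ (InQ.upper i') (≼-trans (InQ.lower i _ p'∈E p'≺p) q≼q'))

-- Linear orders

open Lin

record IsStrict (B : Lin) : Set where
  field
    eq-sym : ∀ {x y} → eqL B x y → eqL B y x
    eq-trans : ∀ {x y z} → eqL B x y → eqL B y z → eqL B x z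
    irrefl : ∀ {x y} → eqL B x y → ¬ ltL B x y
    lt-trans : ∀ {x y z} → ltL B x y → ltL B y z → ltL B x z
    lt-respˡ : ∀ {x y z} → eqL B x y → ltL B y z → ltL B x z
    lt-respʳ : ∀ {x y z} → ltL B x y → eqL B y z → ltL B x z

omegaTimes-strict : ∀ {L} → IsStrict L → IsStrict (omegaTimes L)
omegaTimes-strict {L} S = record
  { eq-sym = λ (p , i) → S.eq-sym p , sym i
  ; eq-trans = λ (p , i) (q , j) → S.eq-trans p q , trans i j
  ; irrefl = λ { (p , i) (inj₁ l) → S.irrefl p l ; (p , i) (inj₂ (_ , l)) → <⇒≢ l i }
  ; lt-trans = λ { (inj₁ l) (inj₁ m) → inj₁ (S.lt-trans l m) ; (inj₁ l) (inj₂ (q , _)) → inj₁ (S.lt-respʳ l q)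
                 ; (inj₂ (p , _)) (inj₁ m) → inj₁ (S.lt-respˡ p m) ; (inj₂ (p , l)) (inj₂ (q , m)) → inj₂ (S.eq-trans p q , <-trans l m) }
  ; lt-respˡ = λ { (p , refl) (inj₁ l) → inj₁ (S.lt-respˡ p l) ; (p , refl) (inj₂ (q , l)) → inj₂ (S.eq-trans p q , l) }
  ; lt-respʳ = λ { (inj₁ l) (p , refl) → inj₁ (S.lt-respʳ l p) ; (inj₂ (q , l)) (p , refl) → inj₂ (S.eq-trans q p , l) } }
  where module S = IsStrict S

plusFin-strict : ∀ {L} → IsStrict L → ∀ k → IsStrict (plusFin L k)
plusFin-strict {L} S k = record
  { eq-sym = λ { {inj₁ _} {inj₁ _} p → S.eq-sym p ; {inj₂ _} {inj₂ _} p → sym p }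
  ; eq-trans = λ { {inj₁ _} {inj₁ _} {inj₁ _} p q → S.eq-trans p q ; {inj₂ _} {inj₂ _} {inj₂ _} p q → trans p q }
  ; irrefl = λ { {inj₁ _} {inj₁ _} p l → S.irrefl p l ; {inj₂ _} {inj₂ _} p l → <⇒≢ l (cong toℕ p) }
  ; lt-trans = λ { {inj₁ _} {inj₁ _} {inj₁ _} l m → S.lt-trans l m ; {inj₁ _} {inj₁ _} {inj₂ _} _ _ → tt
                 ; {inj₁ _} {inj₂ _} {inj₂ _} _ _ → tt ; {inj₂ _} {inj₂ _} {inj₂ _} l m → <-trans l m }
  ; lt-respˡ = λ { {inj₁ _} {inj₁ _} {inj₁ _} p l → S.lt-respˡ p l ; {inj₁ _} {inj₁ _} {inj₂ _} _ _ → tt ; {inj₂ _} {inj₂ _} {inj₂ _} refl l → l }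
  ; lt-respʳ = λ { {inj₁ _} {inj₁ _} {inj₁ _} l p → S.lt-respʳ l p ; {inj₁ _} {inj₂ _} {inj₂ _} _ _ → tt ; {inj₂ _} {inj₂ _} {inj₂ _} l refl → l } }
  where module S = IsStrict S

OrdIso-plusFin-0 : ∀ {A L} → OrdIso A L → OrdIso A (plusFin L 0)
OrdIso-plusFin-0 (f , f-eq , f-lt , f-onto) = (λ a → inj₁ (f a)) , f-eq , f-lt , λ { (inj₁ b) → f-onto b ; (inj₂ ()) }

OrdIso-plusFin-0⁻ : ∀ {A L} → OrdIso A (plusFin L 0) → OrdIso A L
OrdIso-plusFin-0⁻ {A} {L} (f , f-eq , f-lt , f-onto) = (λ a → out (f a)) , (λ a a' e → out-eq (f a) (f a') (f-eq a a' e)) ,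
    (λ a a' l → out-lt (f a) (f a') (f-lt a a' l)) , λ b → proj₁ (f-onto (inj₁ b)) , out-eq (f (proj₁ (f-onto (inj₁ b)))) (inj₁ b) (proj₂ (f-onto (inj₁ b)))
  where
  out : Carrier (plusFin L 0) → Carrier L
  out (inj₁ b) = b
  out-eq : ∀ x y → eqL (plusFin L 0) x y → eqL L (out x) (out y)
  out-eq (inj₁ _) (inj₁ _) e = e
  out-lt : ∀ x y → ltL (plusFin L 0) x y → ltL L (out x) (out y)
  out-lt (inj₁ _) (inj₁ _) l = l

-- The link between the sets of numbers in the theorem and the sets `E P` of values; it lets both
-- versions share one proof.
record Represents (D : ℕ → Set) (P : Class) : Set where
  field
    stable : ∀ {m} → D m → Stable m
    class : ∀ {m} → D m → holds P (cpx m)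
    fromStable : ∀ {m} → Stable m → holds P (cpx m) → D m

  D-nonZero : ∀ {m} → D m → NonZero m
  D-nonZero d = stable-nonZero (stable d)

  pt : ∀ {m} → D m → V
  pt {m} d = δV m {{D-nonZero d}}

  sound : ∀ {m} (d : D m) → E P (pt d)
  sound d = stable⇒E (stable d) (class d)

  complete : ∀ {z} → E P z → ∃[ m ] Σ (D m) λ d → z ≃ pt d
  complete z∈E = represent (E⇒stable z∈E)
    where
    represent : ∀ {z} → (∃[ m ] Σ (Stable m) λ st → z ≃ δV m {{stable-nonZero st}} × holds P (cpx m)) → ∃[ m ] Σ (D m) λ d → z ≃ pt d
    represent (m , st , q , h) = m , fromStable st h , q

module _ {D P} (R : Represents D P) where
  open Represents R

  PredLin-strict : ∀ v → IsStrict (PredLin D (toVal v))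
  PredLin-strict v = record
    { eq-sym = λ {x} {y} p → ≃⁻ (≃-sym (≃⁺ {el x} {el y} p))
    ; eq-trans = λ {x} {y} {z} p q → ≃⁻ (≃-trans (≃⁺ {el x} {el y} p) (≃⁺ {el y} {el z} q))
    ; irrefl = λ {x} {y} p l → ≺⇒≄ (≺⁺ {el x} {el y} l) (≃⁺ p)
    ; lt-trans = λ {x} {y} {z} p q → ≺⁻ (≺-trans (≺⁺ {el x} {el y} p) (≺⁺ {el y} {el z} q))
    ; lt-respˡ = λ {x} {y} {z} p q → ≺⁻ (≼-≺-trans (≃⇒≼ (≃⁺ {el x} {el y} p)) (≺⁺ {el y} {el z} q))
    ; lt-respʳ = λ {x} {y} {z} p q → ≺⁻ (≺-≼-trans (≺⁺ {el x} {el y} p) (≃⇒≼ (≃⁺ {el y} {el z} q))) }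
    where
    el : Carrier (PredLin D (toVal v)) → V
    el (_ , d , _) = pt d

  module _ {B : Lin} (S : IsStrict B) {m m'} (d : D m) (d' : D m')
           (g : OrdIso (PredLin D (δ m)) B) (h : OrdIso (PredLin D (δ m')) B) (m≺m' : pt d ≺ pt d') where
    private
      module S = IsStrict S
      Pm = PredLin D (δ m)
      Pm' = PredLin D (δ m')

      el : Carrier Pm → V
      el (_ , c , _) = pt c

      include : Carrier Pm → Carrier Pm'
      include (x , c , l) = x , c , ≺⁻ (≺-trans (≺⁺ {pt c} {pt d} l) m≺m')

      back : Carrier Pm' → Carrier Pm
      back a = proj₁ (proj₂ (proj₂ (proj₂ g)) (proj₁ h a))

      back-eq : ∀ a → eqL B (proj₁ g (back a)) (proj₁ h a)
      back-eq a = proj₂ (proj₂ (proj₂ (proj₂ g)) (proj₁ h a))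

      back-mono : ∀ a b → ltL Pm' a b → ltL Pm (back a) (back b)
      back-mono a b a<b with ≺-or-≽ (el (back a)) (el (back b))
      ... | inj₁ p = ≺⁻ p
      ... | inj₂ q with ≼⇒≺⊎≃ q
      ... | inj₁ (≺⁺ b<a) = ⊥-elim (S.irrefl (S.eq-sym (back-eq a)) (S.lt-trans (proj₁ (proj₂ (proj₂ h)) a b a<b)
              (S.lt-respˡ (S.eq-sym (back-eq b)) (proj₁ (proj₂ (proj₂ g)) (back b) (back a) b<a))))
      ... | inj₂ (≃⁺ b≈a) = ⊥-elim (S.irrefl (S.eq-trans (S.eq-sym (back-eq a))
              (S.eq-trans (S.eq-sym (proj₁ (proj₂ g) (back b) (back a) b≈a)) (back-eq b))) (proj₁ (proj₂ (proj₂ h)) a b a<b))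

      descend : ∀ a → AccC P (el a) → el (back (include a)) ≺ el a → ⊥
      descend a (acc f) l = descend (back (include a)) (f _ (proj₁ (sound (proj₁ (proj₂ (back (include a)))))) l)
        (≺⁺ (back-mono (include (back (include a))) (include a) (≺⁻ l)))

    -- Going through `B`, the longer segment maps strictly monotonically into the shorter one. Its
    -- element `m` lands below `m`, and iterating gives an infinite descent in D.
    no-shorter-iso : ⊥
    no-shorter-iso = descend a (accC P (el a)) (≺⁺ (back-mono (include a) top (proj₂ (proj₂ a))))
      where
      top : Carrier Pm'
      top = m , d , ≺⁻ m≺m'
      a : Carrier Pm
      a = back top

  iso-unique : ∀ {B} → IsStrict B → ∀ {m m'} (d : D m) (d' : D m') →
               OrdIso (PredLin D (δ m)) B → OrdIso (PredLin D (δ m')) B → pt d ≃ pt d'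
  iso-unique S d d' g h with ≺-or-≽ (pt d) (pt d')
  ... | inj₁ p = ⊥-elim (no-shorter-iso S d d' g h p)
  ... | inj₂ p with ≼⇒≺⊎≃ p
  ... | inj₁ q = ⊥-elim (no-shorter-iso S d' d h g q)
  ... | inj₂ q = ≃-sym q

-- Order types of initial segments.

module Canonical {D D' P} (R : Represents D P) (R' : Represents D' (prev P)) {n} (n∈D' : D' n) where
  private
    module R = Represents R
    module R' = Represents R'

  N : V
  N = R'.pt n∈D'

  N∈E : E (prev P) N
  N∈E = R'.sound n∈D'

  L : Lin
  L = PredLin D' (δ n)

  module _ {m k} (d : D m) (m-rank : Rank P N k (R.pt d)) where
    private
      A = PredLin D (δ m)
      B = plusFin (omegaTimes L) k

      -- The graph of the isomorphism: `q` goes to its owner and its rank in the block. The copies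
      -- of ω are the blocks of owners before `N`; the finite tail is the part of the block of `N`
      -- that precedes `m`.
      Img : V → Carrier B → Set
      Img q (inj₁ ((_ , e , _) , j)) = Rank P (R'.pt e) j q
      Img q (inj₂ i) = Rank P N (toℕ i) q

      N≼ : ∀ {e} → E (prev P) e → e ≺ N → up e ≼ R.pt d
      N≼ = InQ.lower (Rank-InQ m-rank) _

      img : ∀ {q} → E P q → q ≺ R.pt d → ∃[ b ] Img q b
      img {q} q∈E q≺m = located (owner {P} N∈E q∈E (≺-trans q≺m (InQ.upper (Rank-InQ m-rank))))
        where
        last : ∀ {j} → Rank P N j q → ∃[ b ] Img q b
        last r = inj₂ (fromℕ< j<k) , subst (λ i → Rank P N i q) (sym (toℕ-fromℕ< j<k)) r
          where
          j<k = Rank-cancel-≺ ≃-refl r m-rank q≺m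
        ranked : ∀ {p} → p ≼ N → ∃[ j ] Rank P p j q → (∃[ e ] Σ (D' e) λ e∈D' → p ≃ R'.pt e∈D') → ∃[ b ] Img q b
        ranked p≼N (j , r) (e , e∈D' , p≃e) =
          [ (λ p≺N → inj₁ ((e , e∈D' , ≺⁻ (≼-≺-trans (≃⇒≽ p≃e) p≺N)) , j) , Rank-resp p≃e r) , (λ p≃N → last (Rank-resp p≃N r)) ]′ (≼⇒≺⊎≃ p≼N)
        located : (∃[ p ] E (prev P) p × p ≼ N × InQ P p q) → ∃[ b ] Img q b
        located (p , p∈E , p≼N , i) = ranked p≼N (rank {P} p∈E i) (R'.complete p∈E)

      Img-eq : ∀ b b' {q q'} → Img q b → Img q' b' → q ≃ q' → eqL B b b'
      Img-eq (inj₁ ((_ , e , _) , _)) (inj₁ ((_ , e' , _) , _)) r r' q≃q' = ≃⁻ e≃e' , Rank-unique e≃e' r r' q≃q'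
        where
        e≃e' : R'.pt e ≃ R'.pt e'
        e≃e' = ≼-antisym (owner-mono (Rank-InQ r) (Rank-InQ r') (R'.sound e') (≃⇒≼ q≃q')) (owner-mono (Rank-InQ r') (Rank-InQ r) (R'.sound e) (≃⇒≽ q≃q'))
      Img-eq (inj₂ _) (inj₂ _) r r' q≃q' = toℕ-injective (Rank-unique ≃-refl r r' q≃q')
      Img-eq (inj₁ ((_ , e , e≺N) , _)) (inj₂ _) r r' q≃q' =
        ≺⇒⋡ (≺⁺ {R'.pt e} {N} e≺N) (owner-mono (Rank-InQ r') (Rank-InQ r) (R'.sound e) (≃⇒≽ q≃q'))
      Img-eq (inj₂ _) (inj₁ ((_ , e , e≺N) , _)) r r' q≃q' =
        ≺⇒⋡ (≺⁺ {R'.pt e} {N} e≺N) (owner-mono (Rank-InQ r) (Rank-InQ r') (R'.sound e) (≃⇒≼ q≃q'))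

      Img-lt : ∀ b b' {q q'} → Img q b → Img q' b' → q ≺ q' → ltL B b b'
      Img-lt (inj₁ ((_ , e , _) , _)) (inj₁ ((_ , e' , _) , _)) r r' q≺q' =
        [ (λ e≺e' → inj₁ (≺⁻ {R'.pt e} {R'.pt e'} e≺e')) , (λ e≃e' → inj₂ (≃⁻ {R'.pt e} {R'.pt e'} e≃e' , Rank-cancel-≺ e≃e' r r' q≺q')) ]′
          (≼⇒≺⊎≃ (owner-mono (Rank-InQ r) (Rank-InQ r') (R'.sound e') (≺⇒≼ q≺q')))
      Img-lt (inj₂ _) (inj₂ _) r r' q≺q' = Rank-cancel-≺ ≃-refl r r' q≺q'
      Img-lt (inj₁ _) (inj₂ _) r r' q≺q' = tt
      Img-lt (inj₂ _) (inj₁ ((_ , e , e≺N) , _)) r r' q≺q' =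
        ≺⇒⋡ (≺⁺ {R'.pt e} {N} e≺N) (owner-mono (Rank-InQ r) (Rank-InQ r') (R'.sound e) (≺⇒≼ q≺q'))

      Img-onto : ∀ b → ∃[ q ] E P q × q ≺ R.pt d × Img q b
      Img-onto (inj₁ ((_ , e , e≺N) , j)) = result (nth {P} (R'.sound e) j)
        where
        result : ∃[ q ] Rank P (R'.pt e) j q → ∃[ q ] E P q × q ≺ R.pt d × Rank P (R'.pt e) j q
        result (q , r) = q , InQ.isE (Rank-InQ r) , ≺-≼-trans (InQ.upper (Rank-InQ r)) (N≼ (R'.sound e) (≺⁺ e≺N)) , r
      Img-onto (inj₂ i) = result (nth {P} N∈E (toℕ i))
        where
        result : ∃[ q ] Rank P N (toℕ i) q → ∃[ q ] E P q × q ≺ R.pt d × Rank P N (toℕ i) q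
        result (q , r) = q , InQ.isE (Rank-InQ r) , Rank-mono-< ≃-refl r m-rank (toℕ<n i) , r

      f : (a : Carrier A) → ∃[ b ] Img (R.pt (proj₁ (proj₂ a))) b
      f (_ , c , l) = img (R.sound c) (≺⁺ l)

    canonical-iso : OrdIso A B
    canonical-iso = (λ a → proj₁ (f a)) , (λ a a' e → Img-eq _ _ (proj₂ (f a)) (proj₂ (f a')) (≃⁺ e)) ,
                    (λ a a' l → Img-lt _ _ (proj₂ (f a)) (proj₂ (f a')) (≺⁺ l)) , onto
      where
      onto : ∀ b → ∃[ a ] eqL B (proj₁ (f a)) b
      onto b = lift (Img-onto b)
        where
        chosen : ∀ {q} → q ≺ R.pt d → Img q b → (∃[ x ] Σ (D x) λ c → q ≃ R.pt c) → ∃[ a ] eqL B (proj₁ (f a)) b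
        chosen q≺m i (x , c , q≃c) = a , Img-eq _ b (proj₂ (f a)) i (≃-sym q≃c)
          where
          a : Carrier A
          a = x , c , ≺⁻ (≼-≺-trans (≃⇒≽ q≃c) q≺m)
        lift : (∃[ q ] E P q × q ≺ R.pt d × Img q b) → ∃[ a ] eqL B (proj₁ (f a)) b
        lift (q , q∈E , q≺m , i) = chosen q≺m i (R.complete q∈E)

  S I : Val → Set
  S = OmegaAlphaPlusK D L
  I = IntervalSet D L (plusOne (δ n))

  B-strict : ∀ k → IsStrict (plusFin (omegaTimes L) k)
  B-strict = plusFin-strict (omegaTimes-strict (PredLin-strict R' N))

  InBlock : Val → Set
  InBlock v = ∃[ m ] Σ (D m) λ d → v ≈ᵥ δ m × InQ P N (R.pt d)

  rank⇒iso : ∀ {m k q} (d : D m) → Rank P N k q → q ≃ R.pt d → OrdIso (PredLin D (δ m)) (plusFin (omegaTimes L) k)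
  rank⇒iso d r q≃d = canonical-iso d (Rank-respʳ q≃d r)

  -- The element of rank `k` in the block of `N` has an isomorphism onto the same order, so by
  -- uniqueness it has the same value as `m`.
  iso⇒InQ : ∀ {m k} (d : D m) → OrdIso (PredLin D (δ m)) (plusFin (omegaTimes L) k) → InQ P N (R.pt d)
  iso⇒InQ {k = k} d g = against (nth {P} N∈E k)
    where
    against : ∃[ q ] Rank P N k q → InQ P N (R.pt d)
    against (q , r) = conclude (R.complete (InQ.isE (Rank-InQ r)))
      where
      conclude : (∃[ m' ] Σ (D m') λ d' → q ≃ R.pt d') → InQ P N (R.pt d)
      conclude (m' , d' , q≃d') = InQ-respʳ (≃-trans q≃d' (≃-sym (iso-unique R (B-strict k) d d' g (rank⇒iso d' r q≃d')))) (Rank-InQ r)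

  S⇒InBlock : ∀ v → S v → InBlock v
  S⇒InBlock v (m , d , v≈ , k , g) = m , d , v≈ , iso⇒InQ d g

  InBlock⇒S : ∀ v → InBlock v → S v
  InBlock⇒S v (m , d , v≈ , i) = result (rank {P} N∈E i)
    where
    result : ∃[ k ] Rank P N k (R.pt d) → S v
    result (k , r) = m , d , v≈ , k , canonical-iso d r

  I⇒InBlock : ∀ v → I v → InBlock v
  I⇒InBlock v (m , d , v≈ , m<N+1 , x , c , g , x≤m) = m , d , v≈ , mkInQ (R.sound d) (≺⁺ m<N+1)
      (λ e e∈E e≺N → ≼-trans (InQ.lower (iso⇒InQ c (OrdIso-plusFin-0 g)) e e∈E e≺N) (≼⁺ {R.pt c} x≤m))

  InBlock⇒I : ∀ v → InBlock v → I v
  InBlock⇒I v (m , d , v≈ , i) = start (nth {P} N∈E 0)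
    where
    chosen : ∀ {q} → Rank P N 0 q → (∃[ x ] Σ (D x) λ c → q ≃ R.pt c) → I v
    chosen r@(first _ q≼) (x , c , q≃c) = m , d , v≈ , ≺⁻ (InQ.upper i) , x , c ,
        OrdIso-plusFin-0⁻ {L = omegaTimes L} (rank⇒iso c r q≃c) , ≼⁻ (≼-trans (≃⇒≽ q≃c) (q≼ _ i))
    start : ∃[ q ] Rank P N 0 q → I v
    start (q , r) = chosen r (R.complete (InQ.isE (Rank-InQ r)))

  sameSet : SameSet S I
  sameSet v = InBlock⇒I v ∘ S⇒InBlock v , InBlock⇒S v ∘ I⇒InBlock v

-- The numbers b (a 3^k + 1) and stable complexity.

-- `v` is an arbitrary pair, possibly with number 0, hence not in `V`; only the middle value has to
-- be cancelled.
≈ᵥ-≃-trans : ∀ v {x y} → v ≈ᵥ toVal x → x ≃ y → v ≈ᵥ toVal y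
≈ᵥ-≃-trans (c , m) {x} {y} p (≃⁺ q) = *-cancelʳ-≡ _ _ (arg x ^ 3) {{m^n≢0 (arg x) 3}} (begin
  3 ^ c * arg y ^ 3 * arg x ^ 3 ≡⟨ *-swap23 (3 ^ c) (arg y ^ 3) (arg x ^ 3) ⟩
  3 ^ c * arg x ^ 3 * arg y ^ 3 ≡⟨ cong (_* arg y ^ 3) p ⟩
  3 ^ co x * m ^ 3 * arg y ^ 3 ≡⟨ *-swap23 (3 ^ co x) (m ^ 3) (arg y ^ 3) ⟩
  3 ^ co x * arg y ^ 3 * m ^ 3 ≡⟨ cong (_* m ^ 3) q ⟩
  3 ^ co y * arg x ^ 3 * m ^ 3 ≡⟨ *-swap23 (3 ^ co y) (arg x ^ 3) (m ^ 3) ⟩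
  3 ^ co y * m ^ 3 * arg x ^ 3 ∎)
  where open ≡-Reasoning

Any-toVal : ∀ v {x ℓ} → v ≈ᵥ toVal x → Any (x ≃_) ℓ → Any (v ≈ᵥ_) (map toVal ℓ)
Any-toVal v v≈x = Any.map⁺ ∘ Any.map (≈ᵥ-≃-trans v v≈x)

size≡1⇒eval≡1 : ∀ e → size e ≡ 1 → eval e ≡ 1
size≡1⇒eval≡1 one _ = refl
size≡1⇒eval≡1 (a ⊕ b) p = ⊥-elim (<⇒≢ (+-mono-≤ (size>0 a) (size>0 b)) (sym p))
size≡1⇒eval≡1 (a ⊗ b) p = ⊥-elim (<⇒≢ (+-mono-≤ (size>0 a) (size>0 b)) (sym p))

-- The stable complexity of `a` is `cpx (3 ^ K * a) - 3 * K`, with the subtraction moved to the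
-- other side. Multiplying `e` by 3^K gives a multiple of a stable number, whose complexity is
-- known.
size-≥-stable : ∀ e α K a → eval e ≡ 3 ^ α * a → Stable (3 ^ K * a) → cpx (3 ^ K * a) + 3 * α ≤ size e + 3 * K
size-≥-stable e α K a p st = begin
  cpx (3 ^ K * a) + 3 * α ≡⟨ +-comm _ (3 * α) ⟩
  3 * α + cpx (3 ^ K * a) ≡⟨ st α ⟨
  cpx (3 ^ α * (3 ^ K * a)) ≤⟨ cpx-≤ (pow3 K e) (trans (eval-pow3 K e) (trans (cong (3 ^ K *_) p) (*-swap-3^ K α a))) ⟩
  size (pow3 K e) ≡⟨ trans (size-pow3 K e) (+-comm (3 * K) (size e)) ⟩
  size e + 3 * K ∎
  where open ≤-Reasoning

module TSets {n kn} (3∤n : ¬ (3 ∣ n)) (M-stable : Stable (3 ^ kn * n)) where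

  M : ℕ
  M = 3 ^ kn * n

  instance
    M≢0 : NonZero M
    M≢0 = stable-nonZero M-stable

    n≢0 : NonZero n
    n≢0 = m*n≢0⇒n≢0 (3 ^ kn)

  N : V
  N = δV M

  -- Subadditivity of stable complexity without subtraction: by stability of `M` the left side is
  -- the complexity of 3^(K + K') M, which regroups into a product.
  cpx-M-≤ : ∀ {a b} K K' .{{_ : NonZero a}} .{{_ : NonZero b}} → a * b ≡ n →
            cpx M + 3 * K + 3 * K' ≤ cpx (3 ^ K * a) + cpx (3 ^ K' * b) + 3 * kn
  cpx-M-≤ {a} {b} K K' p = begin
    cpx M + 3 * K + 3 * K' ≡⟨ lem (cpx M) K K' ⟩
    3 * (K + K') + cpx M ≡⟨ M-stable (K + K') ⟨
    cpx (3 ^ (K + K') * (3 ^ kn * n)) ≡⟨ cong cpx (begin-equality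
      3 ^ (K + K') * (3 ^ kn * n) ≡⟨ cong₂ (λ x y → x * (3 ^ kn * y)) (^-distribˡ-+-* 3 K K') (sym p) ⟩
      3 ^ K * 3 ^ K' * (3 ^ kn * (a * b)) ≡⟨ lem₂ (3 ^ K) (3 ^ K') (3 ^ kn) a b ⟩
      3 ^ kn * (3 ^ K * a * (3 ^ K' * b)) ∎) ⟩
    cpx (3 ^ kn * (3 ^ K * a * (3 ^ K' * b))) ≤⟨ cpx-3^* kn _ {{m*n≢0 _ _ {{nza}} {{nzb}}}} ⟩
    3 * kn + cpx (3 ^ K * a * (3 ^ K' * b)) ≤⟨ +-monoʳ-≤ (3 * kn) (cpx-* (3 ^ K * a) (3 ^ K' * b) {{nza}} {{nzb}}) ⟩
    3 * kn + (cpx (3 ^ K * a) + cpx (3 ^ K' * b)) ≡⟨ +-comm (3 * kn) _ ⟩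
    cpx (3 ^ K * a) + cpx (3 ^ K' * b) + 3 * kn ∎
    where
    open ≤-Reasoning
    nza : NonZero (3 ^ K * a)
    nza = m*n≢0 (3 ^ K) a {{3^≢0 K}}
    nzb : NonZero (3 ^ K' * b)
    nzb = m*n≢0 (3 ^ K') b {{3^≢0 K'}}
    lem : ∀ c k k' → c + 3 * k + 3 * k' ≡ 3 * (k + k') + c
    lem = solve-∀
    lem₂ : ∀ x y z a b → x * y * (z * (a * b)) ≡ z * (x * a * (y * b))
    lem₂ = solve-∀

  -- The inequalities between complexities are forced to be equalities, so the small summand is 1.
  module FromExceptional {m} (m-stable : Stable m) (a b r : Expr) (eval-≡ : (eval a + eval b) * eval r ≡ m * 3)
      {s t} (arg-≡ : 3 ^ s * (eval a * eval r) ≡ 3 ^ t * M) (co-≡ : size a + size r + pred (size b) + 3 * s ≡ cpx M + 3 * t)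
      {α a'} (a≡ : eval a ≡ 3 ^ α * a') (3∤a' : ¬ (3 ∣ a')) {β r'} (r≡ : eval r ≡ 3 ^ β * r') (3∤r' : ¬ (3 ∣ r'))
      {Ka Kr} (a-stable : Stable (3 ^ Ka * a')) (r-stable : Stable (3 ^ Kr * r')) where

    -- This is where n is prime to 3: the parts of `a` and `r` prime to 3 multiply to n itself, not
    -- just to n up to a power of 3.
    exponents : s + α + β ≡ t + kn × a' * r' ≡ n
    exponents = 3-part-unique (s + α + β) (t + kn) (a' * r') n (3∤* 3∤a' 3∤r') 3∤n (begin
      3 ^ (s + α + β) * (a' * r') ≡⟨ cong (_* (a' * r')) (trans (^-distribˡ-+-* 3 (s + α) β) (cong (_* 3 ^ β) (^-distribˡ-+-* 3 s α))) ⟩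
      3 ^ s * 3 ^ α * 3 ^ β * (a' * r') ≡⟨ lem (3 ^ s) (3 ^ α) (3 ^ β) a' r' ⟩
      3 ^ s * (3 ^ α * a' * (3 ^ β * r')) ≡⟨ cong₂ (λ x y → 3 ^ s * (x * y)) a≡ r≡ ⟨
      3 ^ s * (eval a * eval r) ≡⟨ arg-≡ ⟩
      3 ^ t * (3 ^ kn * n) ≡⟨ *-assoc (3 ^ t) (3 ^ kn) n ⟨
      3 ^ t * 3 ^ kn * n ≡⟨ cong (_* n) (^-distribˡ-+-* 3 t kn) ⟨
      3 ^ (t + kn) * n ∎)
      where
      open ≡-Reasoning
      lem : ∀ x y z a b → x * y * z * (a * b) ≡ x * (y * a * (z * b))
      lem = solve-∀

    ca cr : ℕ
    ca = cpx (3 ^ Ka * a')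
    cr = cpx (3 ^ Kr * r')

    instance
      a'≢0 : NonZero a'
      a'≢0 = m*n≢0⇒n≢0 (3 ^ Ka) {{stable-nonZero a-stable}}
      r'≢0 : NonZero r'
      r'≢0 = m*n≢0⇒n≢0 (3 ^ Kr) {{stable-nonZero r-stable}}

    upper : cpx M + 3 * Ka + 3 * Kr ≤ ca + cr + 3 * kn
    upper = cpx-M-≤ Ka Kr (proj₂ exponents)

    lower : ca + cr + 3 * kn + pred (size b) ≤ cpx M + 3 * Ka + 3 * Kr
    lower = +-cancelʳ-≤ (3 * t) _ _ (begin
      ca + cr + 3 * kn + pred (size b) + 3 * t ≡⟨ lem₁ ca cr kn (pred (size b)) t ⟩
      ca + cr + 3 * (t + kn) + pred (size b) ≡⟨ cong (λ x → ca + cr + 3 * x + pred (size b)) (proj₁ exponents) ⟨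
      ca + cr + 3 * (s + α + β) + pred (size b) ≡⟨ lem₂ ca cr s α β (pred (size b)) ⟩
      (ca + 3 * α) + (cr + 3 * β) + (3 * s + pred (size b))
        ≤⟨ +-monoˡ-≤ (3 * s + pred (size b)) (+-mono-≤ (size-≥-stable a α Ka a' a≡ a-stable) (size-≥-stable r β Kr r' r≡ r-stable)) ⟩
      (size a + 3 * Ka) + (size r + 3 * Kr) + (3 * s + pred (size b)) ≡⟨ lem₃ (size a) Ka (size r) Kr s (pred (size b)) ⟩
      (size a + size r + pred (size b) + 3 * s) + 3 * Ka + 3 * Kr ≡⟨ cong (λ x → x + 3 * Ka + 3 * Kr) co-≡ ⟩
      cpx M + 3 * t + 3 * Ka + 3 * Kr ≡⟨ lem₄ (cpx M) t Ka Kr ⟩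
      cpx M + 3 * Ka + 3 * Kr + 3 * t ∎)
      where
      open ≤-Reasoning
      lem₁ : ∀ a c k p t → a + c + 3 * k + p + 3 * t ≡ a + c + 3 * (t + k) + p
      lem₁ = solve-∀
      lem₂ : ∀ a c s x y p → a + c + 3 * (s + x + y) + p ≡ (a + 3 * x) + (c + 3 * y) + (3 * s + p)
      lem₂ = solve-∀
      lem₃ : ∀ a k r l s p → (a + 3 * k) + (r + 3 * l) + (3 * s + p) ≡ (a + r + p + 3 * s) + 3 * k + 3 * l
      lem₃ = solve-∀
      lem₄ : ∀ c t k l → c + 3 * t + 3 * k + 3 * l ≡ c + 3 * k + 3 * l + 3 * t
      lem₄ = solve-∀

    total : cpx M + 3 * Ka + 3 * Kr ≡ ca + cr + 3 * kn
    total = ≤-antisym upper (≤-trans (m≤m+n _ (pred (size b))) lower)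

    pred-size-b : pred (size b) ≡ 0
    pred-size-b = n≤0⇒n≡0 (+-cancelˡ-≤ (ca + cr + 3 * kn) _ _ (≤-trans lower (≤-trans upper (≤-reflexive (sym (+-identityʳ _))))))

    eval-b : eval b ≡ 1
    eval-b = size≡1⇒eval≡1 b (trans (sym (suc-pred (size b) {{>-nonZero (size>0 b)}})) (cong suc pred-size-b))

    number : 3 ^ β * (r' * (a' * 3 ^ α + 1)) ≡ 3 ^ 1 * m
    number = begin
      3 ^ β * (r' * (a' * 3 ^ α + 1)) ≡⟨ lem (3 ^ β) r' a' (3 ^ α) ⟩
      (3 ^ α * a' + 1) * (3 ^ β * r') ≡⟨ cong₂ _*_ (cong₂ _+_ a≡ eval-b) r≡ ⟨
      (eval a + eval b) * eval r ≡⟨ eval-≡ ⟩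
      m * 3 ≡⟨ *-comm m 3 ⟩
      3 * m ∎
      where
      open ≡-Reasoning
      lem : ∀ x r a y → x * (r * (a * y + 1)) ≡ (y * a + 1) * (x * r)
      lem = solve-∀

    tripled : ∀ x → Stable x → x ≡ 3 ^ 1 * m → ∀ v → v ≈ᵥ δ m → v ≈ᵥ δ x
    tripled _ _ refl v v≈ = ≈ᵥ-≃-trans v {δV m} {δV (3 * m) {{m*n≢0 3 m}}} v≈
      (≃-trans (≃-sym (shift3 (cpx m) m)) (coord-≡ {{m*n≢0 3 m}} {{m*n≢0 3 m}} (sym (m-stable 1)) refl))
      where
      instance
        m≢0 : NonZero m
        m≢0 = stable-nonZero m-stable

    inT : ∀ v → v ≈ᵥ δ m → TSet n kn v
    inT v v≈ = α , a' , r' , Ka , Kr , β , proj₂ exponents , a-stable , r-stable , total , st ,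
               tripled (3 ^ β * (r' * (a' * 3 ^ α + 1))) st number v v≈
      where
      st : Stable (3 ^ β * (r' * (a' * 3 ^ α + 1)))
      st = subst Stable (sym number) (stable-3^ 1 m-stable)

  exceptional⇒T : ∀ {m} → Stable m → ∀ a b r → (eval a + eval b) * eval r ≡ m * 3 → val₊ (a ⊗ r) (pred (size b)) ≃ N →
                  ∀ v → v ≈ᵥ δ m → TSet n kn v
  exceptional⇒T st a b r p q v v≈ = choose (≃⇒3^ q) (3-part (eval a) (eval a) {{eval-nonZero a}} ≤-refl) (3-part (eval r) (eval r) {{eval-nonZero r}} ≤-refl)
    where
    choose : (∃[ s ] ∃[ t ] 3 ^ s * (eval a * eval r) ≡ 3 ^ t * M × size a + size r + pred (size b) + 3 * s ≡ cpx M + 3 * t) →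
             (∃[ α ] ∃[ a' ] eval a ≡ 3 ^ α * a' × ¬ (3 ∣ a')) → (∃[ β ] ∃[ r' ] eval r ≡ 3 ^ β * r' × ¬ (3 ∣ r')) → TSet n kn v
    choose (s , t , arg-≡ , co-≡) (α , a' , a≡ , 3∤a') (β , r' , r≡ , 3∤r') = conclude
        (stable-exists a' {{m*n≢0⇒n≢0 (3 ^ α) {{subst NonZero a≡ (eval-nonZero a)}}}})
        (stable-exists r' {{m*n≢0⇒n≢0 (3 ^ β) {{subst NonZero r≡ (eval-nonZero r)}}}})
      where
      conclude : (∃[ K ] Stable (3 ^ K * a')) → (∃[ K ] Stable (3 ^ K * r')) → TSet n kn v
      conclude (Ka , a-stable) (Kr , r-stable) =
        FromExceptional.inT st a b r p {s} {t} arg-≡ co-≡ {α} {a'} a≡ 3∤a' {β} {r'} r≡ 3∤r' {Ka} {Kr} a-stable r-stable v v≈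

-- The symmetric difference.

-- One threshold for k has to make 3^k a stable for all divisors a of n simultaneously.
stable-below : ∀ n → ∃[ K ] (∀ a .{{_ : NonZero a}} → a ≤ n → Stable (3 ^ K * a))
stable-below zero = 0 , λ { (suc _) () }
stable-below (suc n) = combine (stable-below n) (stable-exists (suc n))
  where
  combine : ∃[ K ] (∀ a .{{_ : NonZero a}} → a ≤ n → Stable (3 ^ K * a)) → ∃[ K ] Stable (3 ^ K * suc n) →
            ∃[ K ] (∀ a .{{_ : NonZero a}} → a ≤ suc n → Stable (3 ^ K * a))
  combine (K , st) (K' , st') = K ⊔ K' , λ a a≤ → split a (m≤n⇒m<n∨m≡n a≤)
    where
    split : ∀ a .{{_ : NonZero a}} → a < suc n ⊎ a ≡ suc n → Stable (3 ^ (K ⊔ K') * a)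
    split a (inj₁ a<) = stable-mono {K} (m≤m⊔n K K') (st a (s≤s⁻¹ a<))
    split a (inj₂ refl) = stable-mono {K'} (m≤n⊔m K K') st'

module SymmetricDifference {D D' P} (R : Represents D P) (R' : Represents D' (prev P))
    {n kn} (3∤n : ¬ (3 ∣ n)) (M∈D' : D' (3 ^ kn * n)) where

  module R = Represents R
  module R' = Represents R'

  M-stable : Stable (3 ^ kn * n)
  M-stable = R'.stable M∈D'

  open Canonical R R' M∈D' using (N; N∈E; S; InBlock; InBlock⇒S; S⇒InBlock)
  open TSets {n} {kn} 3∤n M-stable using (M; M≢0; n≢0; exceptional⇒T)

  T : Val → Set
  T = TSet n kn

  module S∖T where
    open Block {P} N∈E using (r; gap; up-r≺)
    open Floor (floor (prev P) N) using (σ; v≺σ) renaming (base to floor-base; gap to floor-gap)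

    -- Below, `N` is isolated because it lies in `E`; above, because `C (prev P)` has no limits from
    -- above.
    only-N : ∀ z → C (prev P) z → r ≺ z → z ≺ σ → z ≃ N
    only-N z c r≺z z≺σ = [ (λ z≺N → ⊥-elim (gap z c r≺z z≺N)) , (λ N≼z → [ (λ N≺z → ⊥-elim (floor-gap z c (floor≺ N≺z) z≺σ)) , ≃-sym ]′ (≼⇒≺⊎≃ N≼z)) ]′ (≺-or-≽ z N)
      where
      floor≺ : N ≺ z → Floor.w (floor (prev P) N) ≺ z
      floor≺ N≺z = [ (λ b → ≼-≺-trans (proj₂ b) N≺z) , (λ e → subst (_≺ z) (sym e) (low≺C c)) ]′ floor-base

    -- The upper end is the limit `N + 1` of the block, admissible as N < σ; so one list serves the
    -- whole block.
    open Cover P r σ (up N) (up-mono-≺ v≺σ) (λ z → z ≃ N) only-N using (B; Exceptional; cover)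

    list : List V
    list = exprList P B

    listed : ∀ v → S v → ¬ T v → Any (v ≈ᵥ_) (map toVal list)
    listed v s ¬t = inBlock (S⇒InBlock v s)
      where
      module _ {m} (d : D m) (v≈ : v ≈ᵥ δ m) (i : InQ P N (R.pt d)) where
        val≃ : ∀ {e} → eval e ≡ m → size e ≡ cpx m → val e ≃ R.pt d
        val≃ {e} p q = coord-≡ {{eval-nonZero e}} {{R.D-nonZero d}} q p
        covered : ∀ e → eval e ≡ m → size e ≡ cpx m →
                  (∃[ e' ] size e' ≤ B × holds P (size e') × val e ≃ val e') ⊎ Exceptional (eval e * 3) → Any (v ≈ᵥ_) (map toVal list)
        covered e p q (inj₁ (e' , s≤B , h , e≃e')) =
          Any-toVal v {R.pt d} v≈ (exprList-∋ {P} {B} e' s≤B h (≃-trans (≃-sym (val≃ {e} p q)) e≃e'))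
        covered e p q (inj₂ x) = ⊥-elim (¬t (exceptional⇒T (R.stable d) left right rest (trans eval-≡ (cong (_* 3) p)) value v v≈))
          where open Exceptional x
        fromShortest : (∃[ e ] eval e ≡ m × size e ≡ cpx m) → Any (v ≈ᵥ_) (map toVal list)
        fromShortest (e , p , q) = covered e p q (cover e (≺-≼-trans (up-r≺ i) (≃⇒≽ (val≃ {e} p q)))
          (≼-trans (≃⇒≼ (val≃ {e} p q)) (≺⇒≼ (InQ.upper i))) (subst (holds P) (sym q) (R.class d)))
      inBlock : InBlock v → Any (v ≈ᵥ_) (map toVal list)
      inBlock (m , d , v≈ , i) = fromShortest d v≈ i (shortest m {{R.D-nonZero d}})

  module T∖S where
    N∈E-all : E all N
    N∈E-all = stable⇒E M-stable tt

    open LeftGap (leftGap N∈E-all) using (r; gap) renaming (r≺q to r≺N)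

    -- Uniformity in the offset is needed: it will be 3^kn b for an arbitrary divisor b of n, hence
    -- at most M.
    lim : ∃[ k₀ ] (∀ k → k₀ ≤ k → ∀ b → b ≤ M → r ≺ near k N b)
    lim = near-limit M r≺N

    stab : ∃[ K ] (∀ a .{{_ : NonZero a}} → a ≤ n → Stable (3 ^ K * a))
    stab = stable-below n

    k₁ : ℕ
    k₁ = proj₁ lim ⊔ proj₁ stab

    term : ℕ → ℕ → ℕ
    term k b = n * 3 ^ k + b

    term≢0 : ∀ k b → NonZero (term k b)
    term≢0 k b = >-nonZero (≤-trans (>-nonZero⁻¹ (n * 3 ^ k) {{m*n≢0 n (3 ^ k) {{n≢0}} {{3^≢0 k}}}}) (m≤m+n _ b))

    stableTerm : ℕ → ℕ → ℕ
    stableTerm k b = 3 ^ proj₁ (stable-exists (term k b) {{term≢0 k b}}) * term k b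

    -- As b (a 3^k + 1) = n 3^k + b, the elements with small k are determined by k and b ≤ n.
    list : List Val
    list = cartesianProductWith (λ k b → δ (stableTerm k b)) (upTo k₁) (upTo (suc n))

    module _ {k a b ka kb j} (ab≡n : a * b ≡ n) (a-stable : Stable (3 ^ ka * a)) (b-stable : Stable (3 ^ kb * b))
             (total : cpx M + 3 * ka + 3 * kb ≡ cpx (3 ^ ka * a) + cpx (3 ^ kb * b) + 3 * kn)
             (y-stable : Stable (3 ^ j * (b * (a * 3 ^ k + 1)))) where

      instance
        a≢0 : NonZero a
        a≢0 = m*n≢0⇒m≢0 a {{subst NonZero (sym ab≡n) n≢0}}
        b≢0 : NonZero b
        b≢0 = m*n≢0⇒n≢0 a {{subst NonZero (sym ab≡n) n≢0}}

      a≤n : a ≤ n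
      a≤n = ≤-trans (m≤m*n a b) (≤-reflexive ab≡n)

      b≤n : b ≤ n
      b≤n = ≤-trans (m≤n*m b a) (≤-reflexive ab≡n)

      y : ℕ
      y = b * (a * 3 ^ k + 1)

      y≡term : y ≡ term k b
      y≡term = trans (lem a b (3 ^ k)) (cong (λ x → x * 3 ^ k + b) ab≡n)
        where
        lem : ∀ a b z → b * (a * z + 1) ≡ a * b * z + b
        lem = solve-∀

      small : k < k₁ → ∀ v → v ≈ᵥ δ (3 ^ j * y) → Any (v ≈ᵥ_) list
      small k<k₁ v v≈ = lose (∈-cartesianProductWith⁺ (λ k b → δ (stableTerm k b)) (∈-upTo⁺ k<k₁) (∈-upTo⁺ (s≤s b≤n)))
        (≈ᵥ-≃-trans v {δV (3 ^ j * y) {{stable-nonZero y-stable}}} {δV (stableTerm k b) {{stable-nonZero t-stable}}} v≈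
          (≃-trans (coord-≡ {{stable-nonZero y-stable}} {{stable-nonZero y-stable′}} (cong (λ x → cpx (3 ^ j * x)) y≡term) (cong (3 ^ j *_) y≡term))
            (stable-unique-≃ j (proj₁ K) (term k b) {{stable-nonZero y-stable′}} {{stable-nonZero t-stable}} y-stable′ t-stable)))
        where
        K = stable-exists (term k b) {{term≢0 k b}}
        t-stable : Stable (stableTerm k b)
        t-stable = proj₂ K
        y-stable′ : Stable (3 ^ j * term k b)
        y-stable′ = subst (λ x → Stable (3 ^ j * x)) y≡term y-stable

      module Large (k₁≤k : k₁ ≤ k) where
        ak-stable : Stable (3 ^ k * a)
        ak-stable = stable-mono {proj₁ stab} (≤-trans (m≤n⊔m (proj₁ lim) (proj₁ stab)) k₁≤k) (proj₂ stab a a≤n)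

        ca cb : ℕ
        ca = cpx (3 ^ k * a)
        cb = cpx (3 ^ kb * b)

        z : V
        z = near k N (3 ^ kn * b)

        r≺z : r ≺ z
        r≺z = proj₂ lim k (≤-trans (m≤m⊔n (proj₁ lim) (proj₁ stab)) k₁≤k) (3 ^ kn * b) (*-monoʳ-≤ (3 ^ kn) b≤n)

        z≺N : z ≺ N
        z≺N = near-≺ k N (3 ^ kn * b) (>-nonZero⁻¹ _ {{m*n≢0 (3 ^ kn) b {{3^≢0 kn}}}})

        module _ (ea eb : Expr) (ea≡ : eval ea ≡ 3 ^ k * a) (sa≡ : size ea ≡ ca) (eb≡ : eval eb ≡ 3 ^ kb * b) (sb≡ : size eb ≡ cb) where

          e : Expr
          e = eb ⊗ (ea ⊕ one)

          eval-e : eval e ≡ 3 ^ kb * y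
          eval-e = trans (cong₂ (λ x z → x * (z + 1)) eb≡ ea≡) (lem (3 ^ kb) b (3 ^ k) a)
            where
            lem : ∀ x b z a → x * b * (z * a + 1) ≡ x * (b * (a * z + 1))
            lem = solve-∀

          size-e : size e ≡ suc (cb + ca)
          size-e = trans (cong₂ (λ x z → x + (z + 1)) sb≡ sa≡) (lem cb ca)
            where
            lem : ∀ b a → b + (a + 1) ≡ suc (b + a)
            lem = solve-∀

          -- The condition on the stable complexities of a, b and n enters here, carried over from
          -- 3^ka a to the likewise stable 3^k a.
          costs : 3 * kn + (cb + ca) ≡ 3 * kb + (3 * k + cpx M)
          costs = +-cancelʳ-≡ (3 * ka + cpA) _ _ (begin
            3 * kn + (cb + ca) + (3 * ka + cpA) ≡⟨ lem₁ kn cb ca ka cpA ⟩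
            (3 * ka + ca) + (cpA + cb + 3 * kn) ≡⟨ cong₂ _+_ (stable-unique k ka {a} ak-stable a-stable) (sym total) ⟩
            (3 * k + cpA) + (cpx M + 3 * ka + 3 * kb) ≡⟨ lem₂ k cpA (cpx M) ka kb ⟩
            3 * kb + (3 * k + cpx M) + (3 * ka + cpA) ∎)
            where
            open ≡-Reasoning
            cpA = cpx (3 ^ ka * a)
            lem₁ : ∀ kn b a ka c → 3 * kn + (b + a) + (3 * ka + c) ≡ (3 * ka + a) + (c + b + 3 * kn)
            lem₁ = solve-∀
            lem₂ : ∀ k c m ka kb → (3 * k + c) + (m + 3 * ka + 3 * kb) ≡ 3 * kb + (3 * k + m) + (3 * ka + c)
            lem₂ = solve-∀

          args : 3 ^ kn * eval e ≡ 3 ^ kb * (3 ^ k * M + 3 ^ kn * b)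
          args = begin
            3 ^ kn * eval e ≡⟨ cong (3 ^ kn *_) (trans eval-e (cong (3 ^ kb *_) y≡term)) ⟩
            3 ^ kn * (3 ^ kb * (n * 3 ^ k + b)) ≡⟨ lem (3 ^ kn) (3 ^ kb) n (3 ^ k) b ⟩
            3 ^ kb * (3 ^ k * (3 ^ kn * n) + 3 ^ kn * b) ∎
            where
            open ≡-Reasoning
            lem : ∀ x y n z b → x * (y * (n * z + b)) ≡ y * (z * (x * n) + x * b)
            lem = solve-∀

          -- Multiplied by 3^kn, the number b (a 3^k + 1) becomes 3^k M + 3^kn b, the number of `z`
          -- on the scale of `M`. The extra cost 1 is that of the summand `one`.
          e≃z+1 : val e ≃ up z
          e≃z+1 = ≃-trans (coord-≡ {{eval-nonZero e}} {{eval-nonZero e}} size-e refl) (up-cong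
            (≃-trans (≃-sym (shift3^ kn (cb + ca) (eval e) {{eval-nonZero e}}))
            (≃-trans (coord-≡ {{m*n≢0 (3 ^ kn) (eval e) {{3^≢0 kn}} {{eval-nonZero e}}}} {{m*n≢0 (3 ^ kb) _ {{3^≢0 kb}} {{z≢0}}}} costs args)
              (shift3^ kb (3 * k + cpx M) (3 ^ k * M + 3 ^ kn * b) {{z≢0}}))))
            where
            z≢0 : NonZero (3 ^ k * M + 3 ^ kn * b)
            z≢0 = >-nonZero (≤-trans (>-nonZero⁻¹ (3 ^ k * M) {{m*n≢0 (3 ^ k) M {{3^≢0 k}}}}) (m≤m+n _ _))

          class : holds P (size e)
          class = holds-≃ P {up z} {val e} (≃-sym e≃z+1) (subst (holds P) (cong suc (+-comm (cpx M) (3 * k))) (+3*⁺ P k (R'.class M∈D')))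

          e∈E : E P (val e)
          e∈E = C-val e class , λ c → gap (dn (val e)) (C-all c) (≺-≼-trans r≺z (≃⇒≽ e-1≃z)) (≼-≺-trans (≃⇒≼ e-1≃z) z≺N)
            where
            e-1≃z : dn (val e) ≃ z
            e-1≃z = ≃-trans (dn-cong e≃z+1) dn-up

          e∈Q : InQ P N (val e)
          e∈Q = mkInQ e∈E (≼-≺-trans (≃⇒≼ e≃z+1) (up-mono-≺ z≺N)) λ x x∈E x≺N → ≼-trans (below x x∈E x≺N) (≃⇒≽ e≃z+1)
            where
            below : ∀ x → E (prev P) x → x ≺ N → up x ≼ up z
            below x x∈E x≺N = [ (λ r≺x → ⊥-elim (gap x (C-all (proj₁ x∈E)) r≺x x≺N)) , (λ x≼r → up-mono-≼ (≼-trans x≼r (≺⇒≼ r≺z))) ]′ (≺-or-≽ r x)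

          e-stable : size e ≡ cpx (eval e) × Stable (eval e)
          e-stable = E-val⇒stable e e∈E class

          y-stable″ : Stable (3 ^ kb * y)
          y-stable″ = subst Stable eval-e (proj₂ e-stable)

          y≃e : δV (3 ^ j * y) {{stable-nonZero y-stable}} ≃ val e
          y≃e = ≃-trans (stable-unique-≃ j kb y {{stable-nonZero y-stable}} {{stable-nonZero y-stable″}} y-stable y-stable″)
            (coord-≡ {{stable-nonZero y-stable″}} {{eval-nonZero e}} (sym (trans (proj₁ e-stable) (cong cpx eval-e))) (sym eval-e))

          inS : ∀ v → v ≈ᵥ δ (3 ^ j * y) → S v
          inS v v≈ = represented (R.complete e∈E)
            where
            represented : (∃[ m ] Σ (D m) λ d → val e ≃ R.pt d) → S v
            represented (m , d , e≃d) = InBlock⇒S v (m , d ,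
              ≈ᵥ-≃-trans v {δV (3 ^ j * y) {{stable-nonZero y-stable}}} {R.pt d} v≈ (≃-trans y≃e e≃d) , InQ-respʳ e≃d e∈Q)

        large : ∀ v → v ≈ᵥ δ (3 ^ j * y) → S v
        large v v≈ = choose (shortest (3 ^ k * a) {{stable-nonZero ak-stable}}) (shortest (3 ^ kb * b) {{stable-nonZero b-stable}})
          where
          choose : (∃[ e ] eval e ≡ 3 ^ k * a × size e ≡ ca) → (∃[ e ] eval e ≡ 3 ^ kb * b × size e ≡ cb) → S v
          choose (ea , ea≡ , sa≡) (eb , eb≡ , sb≡) = inS ea eb ea≡ sa≡ eb≡ sb≡ v v≈

    listed : ∀ v → T v → ¬ S v → Any (v ≈ᵥ_) list
    listed v (k , a , b , ka , kb , j , ab≡n , a-stable , b-stable , total , y-stable , v≈) ¬s =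
      [ (λ k<k₁ → small {k} {a} {b} {ka} {kb} {j} ab≡n a-stable b-stable total y-stable k<k₁ v v≈) ,
        (λ k₁≤k → ⊥-elim (¬s (Large.large {k} {a} {b} {ka} {kb} {j} ab≡n a-stable b-stable total y-stable k₁≤k v v≈))) ]′ (<-≤-connex k k₁)

  finSymDiff : FinSymDiff S T
  finSymDiff = map toVal S∖T.list ++ T∖S.list , λ v →
    [ (λ (s , ¬t) → Any.++⁺ˡ (S∖T.listed v s ¬t)) , (λ (t , ¬s) → Any.++⁺ʳ (map toVal S∖T.list) (T∖S.listed v t ¬s)) ]′

-- Residue classes and the theorem.

residue : ℕ → Class
residue u = record
  { holds = λ c → c % 3 ≡ u ; holds? = λ c → c % 3 ≟ u
  ; +3⁺ = λ {c} → trans (+3-% c) ; +3⁻ = λ {c} → trans (sym (+3-% c)) }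
  where
  +3-% : ∀ c → (3 + c) % 3 ≡ c % 3
  +3-% c = trans (cong (_% 3) (+-comm 3 c)) ([m+n]%n≡m%n c 3)

suc-% : ∀ c → suc c % 3 ≡ suc (c % 3) % 3
suc-% c = %-distribˡ-+ 1 c 3

suc-%-injective : ∀ {a b} → a < 3 → b < 3 → suc a % 3 ≡ suc b % 3 → a ≡ b
suc-%-injective {0} {0} _ _ _ = refl
suc-%-injective {1} {1} _ _ _ = refl
suc-%-injective {2} {2} _ _ _ = refl
suc-%-injective {0} {1} _ _ ()
suc-%-injective {0} {2} _ _ ()
suc-%-injective {1} {0} _ _ ()
suc-%-injective {1} {2} _ _ ()
suc-%-injective {2} {0} _ _ ()
suc-%-injective {2} {1} _ _ ()
suc-%-injective {suc (suc (suc _))} (s≤s (s≤s (s≤s ()))) _ _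
suc-%-injective {_} {suc (suc (suc _))} _ (s≤s (s≤s (s≤s ()))) _

stable⇒2≤ : ∀ {m} → Stable m → 2 ≤ m
stable⇒2≤ {0} st = ⊥-elim (0≢1+n (st 1))
stable⇒2≤ {1} st with st 1
-- `cpx 3` evaluates to 3, while stability of 1 would require 4.
... | ()
stable⇒2≤ {suc (suc m)} _ = s≤s (s≤s z≤n)

Dst-represents : ∀ P → (∀ c → holds P c) → Represents Dst P
Dst-represents P h = record
  { stable = proj₂ ; class = λ _ → h _ ; fromStable = λ st _ → ≤-trans (n≤1+n 1) (stable⇒2≤ st) , st }

DstU-represents : ∀ u P → (∀ c → c % 3 ≡ u → holds P c) → (∀ c → holds P c → c % 3 ≡ u) → Represents (DstU u) P
DstU-represents u P f g = record
  { stable = λ d → proj₁ (proj₂ d) ; class = λ d → f _ (proj₂ (proj₂ d)) ; fromStable = λ st h → stable⇒2≤ st , st , g _ h }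

theorem4p19 : (n kn : ℕ) → ¬ (3 ∣ n) → Stable (3 ^ kn * n) →
    (SameSet (OmegaAlphaPlusK (DstU (suc (cpx (3 ^ kn * n) % 3) % 3)) (PredLin (DstU (cpx (3 ^ kn * n) % 3)) (δ (3 ^ kn * n))))
    (IntervalSet (DstU (suc (cpx (3 ^ kn * n) % 3) % 3)) (PredLin (DstU (cpx (3 ^ kn * n) % 3)) (δ (3 ^ kn * n))) (plusOne (δ (3 ^ kn * n))))
    × FinSymDiff (OmegaAlphaPlusK (DstU (suc (cpx (3 ^ kn * n) % 3) % 3)) (PredLin (DstU (cpx (3 ^ kn * n) % 3)) (δ (3 ^ kn * n))))
    (TSet n kn))
    × (SameSet (OmegaAlphaPlusK Dst (PredLin Dst (δ (3 ^ kn * n))))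
    (IntervalSet Dst (PredLin Dst (δ (3 ^ kn * n))) (plusOne (δ (3 ^ kn * n))))
    × FinSymDiff (OmegaAlphaPlusK Dst (PredLin Dst (δ (3 ^ kn * n)))) (TSet n kn))
theorem4p19 n kn 3∤n st =
    (Canonical.sameSet Rᵤ Rᵤ' (stable⇒2≤ st , st , refl) , SymmetricDifference.finSymDiff Rᵤ Rᵤ' {n} {kn} 3∤n (stable⇒2≤ st , st , refl)) ,
    (Canonical.sameSet R R (≤-trans (n≤1+n 1) (stable⇒2≤ st) , st) ,
     SymmetricDifference.finSymDiff R R {n} {kn} 3∤n (≤-trans (n≤1+n 1) (stable⇒2≤ st) , st))
  where
  c = cpx (3 ^ kn * n)
  R : Represents Dst all
  R = Dst-represents all (λ _ → tt)
  Rᵤ : Represents (DstU (suc (c % 3) % 3)) (residue (suc (c % 3) % 3))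
  Rᵤ = DstU-represents _ _ (λ _ p → p) (λ _ p → p)
  Rᵤ' : Represents (DstU (c % 3)) (prev (residue (suc (c % 3) % 3)))
  Rᵤ' = DstU-represents _ _ (λ x p → trans (suc-% x) (cong (λ r → suc r % 3) p))
    (λ x p → suc-%-injective (m%n<n x 3) (m%n<n c 3) (trans (sym (suc-% x)) p))
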